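{- Let $G$ be a critical graph with $\chi(G) \geq \Delta(G) \geq 6$ such that $\mathcal{H}(G)$ is independent (i.e. has no edges). Then $G$ is the complete graph $K_{\chi(G)}$.
   Context: Graphs are finite and simple. $\chi(G)$ and $\Delta(G)$ denote the chromatic number and the maximum degree of $G$. A graph $G$ is critical if $\chi(G - v) < \chi(G)$ for every vertex $v$ of $G$. For a graph $G$, $\mathcal{H}(G)$ denotes the subgraph of $G$ induced on the vertices of degree at least $\chi(G)$ (possibly with no vertices). -}

module Defs where

open import Level using (Level; 0ℓ)
open import Data.Nat.Base using (ℕ; zero; suc; _^_; _≤_; _<_; z≤n; s≤s)
open import Data.Nat.Properties using (_≤?_)
open import Data.Fin.Base using (Fin; finToFun; funToFin)
open import Data.Fin.Properties using (_≟_; any?; all?; finToFun-funToFin)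
open import Data.List.Base using (List; length; map; filter; lookup; allFin)
open import Data.List.Extrema.Nat using (max)
open import Data.Product.Base using (∃; _×_; _,_; proj₁)
open import Function.Base using (id; _∘_)
open import Function.Bundles using (_↔_; _⇔_; Inverse)
open import Relation.Binary.Core using (Rel)
open import Relation.Binary.Definitions using (Irreflexive; Symmetric)
import Relation.Binary.Definitions as Binary
open import Relation.Binary.PropositionalEquality using (_≡_; _≢_; cong; ≢-sym; subst₂)
open import Relation.Nullary using (¬_; yes; no; ¬?; contradiction)
import Relation.Nullary.Decidable as Dec
open import Relation.Nullary.Decidable using (_→-dec_)
open import Relation.Unary using (Pred; Decidable)

private
  variable
    p : Level

-- Adjacency is decidable: a finite graph is finite data.
record Graph : Set₁ where
  field
    order  : ℕ
    Adj    : Rel (Fin order) 0ℓ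
    adj?   : Binary.Decidable Adj
    symm   : Symmetric Adj
    irrefl : Irreflexive _≡_ Adj

  Vertex : Set
  Vertex = Fin order

  vertices : List Vertex
  vertices = allFin order

  degree : Vertex → ℕ
  degree v = length (filter (adj? v) vertices)

  Edgeless : Set
  Edgeless = ∀ u v → ¬ Adj u v

open Graph public

Δ : Graph → ℕ
Δ G = max 0 (map (degree G) (vertices G))

-- The vertices satisfying P are listed without repetition, and
-- vertex i of the induced subgraph stands for the i-th entry of the list.
induced : (G : Graph) {P : Pred (Vertex G) p} → Decidable P → Graph
induced G P? = record
  { order  = length vs
  ; Adj    = λ i j → Adj G (lookup vs i) (lookup vs j)
  ; adj?   = λ i j → adj? G (lookup vs i) (lookup vs j)
  ; symm   = symm G
  ; irrefl = irrefl G ∘ cong (lookup vs)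
  }
  where vs = filter P? (vertices G)

infixl 6 _-_

_-_ : (G : Graph) → Vertex G → Graph
G - v = induced G (λ u → ¬? (u ≟ v))

K : ℕ → Graph
K n = record
  { order  = n
  ; Adj    = _≢_
  ; adj?   = λ u v → ¬? (u ≟ v)
  ; symm   = ≢-sym
  ; irrefl = λ u≡v u≢v → u≢v u≡v
  }

infix 4 _≅_

record _≅_ (G H : Graph) : Set where
  field
    bijection : Vertex G ↔ Vertex H
    adjacency : ∀ u v → Adj G u v ⇔ Adj H (Inverse.to bijection u) (Inverse.to bijection v)

Proper : (G : Graph) {k : ℕ} → (Vertex G → Fin k) → Set
Proper G c = ∀ u v → Adj G u v → c u ≢ c v

Colorable : Graph → ℕ → Set
Colorable G k = ∃ λ (c : Vertex G → Fin k) → Proper G c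

-- Search through all colorings, coded as elements of Fin (k ^ order G).
colorable? : (G : Graph) → Decidable (Colorable G)
colorable? G k = Dec.map′ decode encode (any? {n = k ^ order G} (proper? ∘ finToFun))
  where
  proper? : Decidable (Proper G {k})
  proper? c = all? λ u → all? λ v → adj? G u v →-dec ¬? (c u ≟ c v)

  decode : ∃ (Proper G ∘ finToFun {k} {order G}) → Colorable G k
  decode (i , proper) = finToFun i , proper

  encode : Colorable G k → ∃ (Proper G ∘ finToFun {k} {order G})
  encode (c , proper) = funToFin c , λ u v uv →
    proper u v uv ∘ subst₂ _≡_ (finToFun-funToFin c u) (finToFun-funToFin c v)

IsLeast : Pred ℕ p → Pred ℕ p
IsLeast P k = P k × (∀ {j} → P j → k ≤ j)

least : {P : Pred ℕ p} → Decidable P → ∀ n → P n → ∃ (IsLeast P)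
least P? n Pn with P? 0
least P? n       Pn | yes P0 = 0 , P0 , λ _ → z≤n
least P? zero    Pn | no ¬P0 = contradiction Pn ¬P0
least {P = P} P? (suc n) Pn | no ¬P0 with least (P? ∘ suc) n Pn
... | k , Pk , minimal = suc k , Pk , minimal′
  where
  minimal′ : ∀ {j} → P j → suc k ≤ j
  minimal′ {zero}  P0 = contradiction P0 ¬P0
  minimal′ {suc j} Pj = s≤s (minimal Pj)

order-colorable : (G : Graph) → Colorable G (order G)
order-colorable G = id , λ u v uv u≡v → irrefl G u≡v uv

chromatic : (G : Graph) → ∃ (IsLeast (Colorable G))
chromatic G = least (colorable? G) (order G) (order-colorable G)

χ : Graph → ℕ
χ G = proj₁ (chromatic G)

Critical : Graph → Set
Critical G = ∀ v → χ (G - v) < χ G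

ℋ : Graph → Graph
ℋ G = induced G (λ v → χ G ≤? degree G v)

{-# OPTIONS --safe #-}

-- Put k = χ(G) − 1. All degrees are k (low vertices) or k + 1 (high vertices, pairwise nonadjacent).
-- Leave one low vertex (the hole) uncolored, split the k colors of the rest into palettes of sizes
-- 2 and k − 2, and minimize the number of edges inside the two sides. Then the hole can travel within
-- its component on either side, which contains two adjacent low vertices u, y since it is not
-- bipartite: move the hole to y, change sides, and repeat. When such a walk first meets a component
-- that it has left before, the hole is adjacent to everything the removed vertex y was adjacent to
-- there and also to y itself, so it must have left that component just two steps earlier. This gives
-- three low vertices with the same closed neighborhood (the hole, u and y).
--
-- Let x be one of three such twins. Two nonadjacent neighbors a, b of x with the same color would allow
-- to color all the twins greedily. Counting degrees, a low neighbor of x can be recolored with the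
-- color of any twin, and a high one with all but one of these colors, so that some two nonadjacent
-- neighbors of x can get the same color; for this χ(G) ≥ 6 is needed. Hence the closed neighborhood
-- of x is a clique, and by criticality it is all of G.

module Submission where

open import Defs
open import Data.Bool.Base using (Bool; true; false; not; if_then_else_)
open import Data.Bool.Properties using (¬-not; not-¬; not-involutive) renaming (_≟_ to _≟ᵇ_)
open import Data.Empty using (⊥; ⊥-elim)
open import Data.Fin.Base using (Fin; zero; suc; toℕ; fromℕ<; punchIn)
open import Data.Fin.Properties
  using (_≟_; any?; all?; toℕ<n; toℕ-injective; toℕ-fromℕ<; injective⇒≤; punchInᵢ≢i)
open import Data.List.Base using (List; []; _∷_; length; filter; lookup; allFin; map; tabulate)
open import Data.List.Extrema.Nat using (xs≤max)
open import Data.List.Membership.Propositional using (_∈_; _∉_)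
open import Data.List.Membership.Propositional.Properties
  using (∈-filter⁺; ∈-filter⁻; ∈-allFin; ∈-lookup; ∈-map⁺)
open import Data.List.Properties using (length-tabulate; length-++)
open import Data.List.Relation.Unary.All as All using (All; []; _∷_)
import Data.List.Relation.Unary.All.Properties as All
open import Data.List.Relation.Unary.AllPairs using ([]; _∷_)
open import Data.List.Relation.Unary.Any as Any using (here; there)
open import Data.List.Relation.Unary.Any.Properties using (lookup-index)
open import Data.List.Relation.Unary.Unique.Propositional using (Unique)
import Data.List.Relation.Unary.Unique.Propositional.Properties as Unique
open import Data.Nat.Base using (ℕ; zero; suc; _+_; _∸_; _≤_; _<_; _≥_; z≤n; s≤s; s≤s⁻¹)
open import Data.Nat.Induction using (<-rec)
import Data.Nat.Properties as ℕ
open import Data.Product.Base using (∃; ∃₂; _×_; _,_; proj₁; proj₂)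
open import Data.Sum.Base using (_⊎_; inj₁; inj₂)
open import Data.Vec.Functional using (updateAt)
open import Data.Vec.Functional.Properties using (updateAt-updates; updateAt-minimal)
open import Function.Base using (id; _∘_; const)
open import Function.Bundles using (mk⇔)
open import Function.Construct.Identity using (↔-id)
open import Level using (Level; 0ℓ)
open import Relation.Binary.Core using (Rel)
open import Relation.Binary.Definitions using (Symmetric)
import Relation.Binary.Definitions as Binary
open import Relation.Binary.PropositionalEquality
  using (_≡_; _≢_; refl; sym; trans; cong; cong₂; subst; subst₂; module ≡-Reasoning)
open import Relation.Nullary using (¬_; Dec; yes; no; ¬?; contradiction)
open import Relation.Nullary.Decidable using (_×-dec_; _→-dec_; decidable-stable; ¬¬-excluded-middle)
open import Relation.Unary using (Pred; Decidable)

open import Algebra.Properties.CommutativeMonoid.Sum ℕ.+-0-commutativeMonoid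
  using (sum; sum-remove; ∑-distrib-+; sum-cong-≗)

private
  variable
    ℓ ℓ₁ ℓ₂ : Level
    A : Set ℓ
    m n : ℕ
    P : Pred (Fin n) ℓ₁
    Q : Pred (Fin n) ℓ₂

-- Counting in finite sets

Unique-lookup-injective : {xs : List A} → Unique xs →
  ∀ {i j} → lookup xs i ≡ lookup xs j → i ≡ j
Unique-lookup-injective (_ ∷ _)   {zero}  {zero}  _  = refl
Unique-lookup-injective (x∉ ∷ _) {zero}  {suc j} eq = contradiction eq (All.lookup x∉ (∈-lookup j))
Unique-lookup-injective (x∉ ∷ _) {suc i} {zero}  eq = contradiction (sym eq) (All.lookup x∉ (∈-lookup i))
Unique-lookup-injective (_ ∷ xs!) {suc i} {suc j} eq = cong suc (Unique-lookup-injective xs! eq)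

length-⊆ : {xs ys : List A} → Unique xs → (∀ {x} → x ∈ xs → x ∈ ys) → length xs ≤ length ys
length-⊆ {xs = xs} {ys} xs! xs⊆ys = injective⇒≤ {f = position} λ {i} {j} eq →
  Unique-lookup-injective xs! (begin
    lookup xs i             ≡⟨ lookup-index (xs⊆ys (∈-lookup i)) ⟩
    lookup ys (position i)  ≡⟨ cong (lookup ys) eq ⟩
    lookup ys (position j)  ≡⟨ lookup-index (xs⊆ys (∈-lookup j)) ⟨
    lookup xs j             ∎)
  where
  open ≡-Reasoning
  position : Fin (length xs) → Fin (length ys)
  position i = Any.index (xs⊆ys (∈-lookup i))

module _ (P? : Decidable {A = Fin n} P) where

  elements : List (Fin n)
  elements = filter P? (allFin n)

  # : ℕ
  # = length elements

  elements! : Unique elements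
  elements! = Unique.filter⁺ P? (Unique.allFin⁺ n)

  ∈-elements⁻ : ∀ {x} → x ∈ elements → P x
  ∈-elements⁻ = proj₂ ∘ ∈-filter⁻ P? {xs = allFin n}

  all-elements : All P elements
  all-elements = All.all-filter P? (allFin n)

  ≤# : ∀ {xs} → Unique xs → All P xs → length xs ≤ #
  ≤# xs! Pxs = length-⊆ xs! λ x∈xs → ∈-filter⁺ P? (∈-allFin _) (All.lookup Pxs x∈xs)

  injection-≤# : (f : Fin m → Fin n) → (∀ {i j} → f i ≡ f j → i ≡ j) → (∀ i → P (f i)) → m ≤ #
  injection-≤# f f-inj Pf = subst (_≤ #) (length-tabulate f) (≤# (Unique.tabulate⁺ f-inj) (All.tabulate⁺ Pf))

  fresh : ∀ ys → length ys < # → ∃ λ x → P x × x ∉ ys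
  fresh ys ys<# with any? (λ x → P? x ×-dec ¬? (Any.any? (x ≟_) ys))
  ... | yes found = found
  ... | no ¬found = contradiction (length-⊆ elements! λ {x} x∈ →
    decidable-stable (Any.any? (x ≟_) ys) λ x∉ys → ¬found (x , ∈-elements⁻ x∈ , x∉ys)) (ℕ.<⇒≱ ys<#)

module _ (P? : Decidable {A = Fin n} P) (Q? : Decidable {A = Fin n} Q) where

  #-mono-< : (∀ {x} → P x → Q x) → ∀ {x} → Q x → ¬ P x → # P? < # Q?
  #-mono-< P⊆Q {x} Qx ¬Px = ≤# Q?
    (All.tabulate (λ y∈ x≡y → ¬Px (subst P (sym x≡y) (∈-elements⁻ P? y∈))) ∷ elements! P?)
    (Qx ∷ All.map P⊆Q (all-elements P?))

#-disjoint-+ : {R : Pred (Fin n) ℓ}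
  (P? : Decidable P) (Q? : Decidable Q) (R? : Decidable R) →
  (∀ {x} → P x → R x) → (∀ {x} → Q x → R x) → (∀ {x} → P x → ¬ Q x) → # P? + # Q? ≤ # R?
#-disjoint-+ P? Q? R? P⊆R Q⊆R P⊥Q = subst (_≤ # R?) (length-++ (elements P?))
  (≤# R? (Unique.++⁺ (elements! P?) (elements! Q?)
           λ (x∈P , x∈Q) → P⊥Q (∈-elements⁻ P? x∈P) (∈-elements⁻ Q? x∈Q))
         (All.++⁺ (All.map P⊆R (all-elements P?)) (All.map Q⊆R (all-elements Q?))))

surjection-≤# : ∀ {k} (P? : Decidable {A = Fin n} P) (c : Fin n → ℕ) →
  (∀ {γ} → γ < k → ∃ λ z → P z × c z ≡ γ) → k ≤ # P?
surjection-≤# P? c onto = injection-≤# P? (λ i → proj₁ (onto (toℕ<n i)))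
  (λ {i} {j} eq → toℕ-injective (trans (sym (proj₂ (proj₂ (onto (toℕ<n i)))))
                    (trans (cong c eq) (proj₂ (proj₂ (onto (toℕ<n j)))))))
  (λ i → proj₁ (proj₂ (onto (toℕ<n i))))

length-≤ : ∀ {xs : List (Fin n)} → Unique xs → length xs ≤ n
length-≤ {n = n} {xs} xs! = subst (length xs ≤_) (length-tabulate {n = n} id) (length-⊆ xs! λ _ → ∈-allFin _)

infixl 20 _[_≔_]

_[_≔_] : (Fin n → A) → Fin n → A → Fin n → A
f [ x ≔ a ] = updateAt f x (const a)

≔-same : (f : Fin n → A) → ∀ x {a} → (f [ x ≔ a ]) x ≡ a
≔-same f x = updateAt-updates x f

≔-other : (f : Fin n → A) → ∀ {x y a} → y ≢ x → (f [ x ≔ a ]) y ≡ f y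
≔-other f y≢x = updateAt-minimal _ _ f y≢x

-- Finitely many instances of excluded middle. Sets such as `Comp` speak of the existence of
-- colorings and carry no decision procedure; where they have to be decided, the goal is `⊥`.
¬¬-decidable : (P : Pred (Fin n) ℓ₁) → ¬ ¬ Decidable P
¬¬-decidable {n = zero}  P k = k λ ()
¬¬-decidable {n = suc n} P k = ¬¬-excluded-middle λ P0? → ¬¬-decidable (P ∘ suc) λ P∘suc? →
  k λ { zero → P0? ; (suc i) → P∘suc? i }

¬¬-minimal : {S : Set ℓ₁} (R : Pred S ℓ₂) (f : S → ℕ) → ∃ R →
  ¬ ¬ ∃ λ x → R x × ∀ y → R y → f x ≤ f y
¬¬-minimal {S = S} R f (x₀ , Rx₀) k = <-rec (λ m → ∀ x → R x → f x ≡ m → ⊥) step (f x₀) x₀ Rx₀ refl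
  where
  step : ∀ m → (∀ {m′} → m′ < m → ∀ x → R x → f x ≡ m′ → ⊥) → ∀ x → R x → f x ≡ m → ⊥
  step m rec x Rx refl = k (x , Rx , λ y Ry → ℕ.≮⇒≥ λ fy<fx → rec fy<fx y Ry refl)

-- Off-diagonal sums of symmetric matrices

sumWithout : (Fin n → Fin n → ℕ) → Fin n → ℕ
sumWithout {suc n} f x = sum λ i → sum λ j → f (punchIn x i) (punchIn x j)

sumWithout-cong : ∀ {f g : Fin n → Fin n → ℕ} x →
  (∀ {i j} → i ≢ x → j ≢ x → f i j ≡ g i j) → sumWithout f x ≡ sumWithout g x
sumWithout-cong {suc n} x f≗g =
  sum-cong-≗ λ i → sum-cong-≗ λ j → f≗g (punchInᵢ≢i x i) (punchInᵢ≢i x j)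

-- Row and column `x` have equal sums by symmetry and share only the diagonal entry, which is zero.
sum-split : ∀ (f : Fin n → Fin n → ℕ) x → (∀ i j → f i j ≡ f j i) → f x x ≡ 0 →
  sum (λ i → sum (f i)) ≡ (sum (f x) + sum (f x)) + sumWithout f x
sum-split {suc n} f x f-sym fxx≡0 = begin
  sum (λ i → sum (f i))
    ≡⟨ sum-remove {i = x} (λ i → sum (f i)) ⟩
  sum (f x) + sum (λ i → sum (f (punchIn x i)))
    ≡⟨ cong (sum (f x) +_) (sum-cong-≗ {n} λ i → sum-remove {i = x} (f (punchIn x i))) ⟩
  sum (f x) + sum (λ i → f (punchIn x i) x + sum (λ j → f (punchIn x i) (punchIn x j)))
    ≡⟨ cong (sum (f x) +_) (∑-distrib-+ (λ i → f (punchIn x i) x) _) ⟩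
  sum (f x) + (sum (λ i → f (punchIn x i) x) + sumWithout f x)
    ≡⟨ cong (λ t → sum (f x) + (t + sumWithout f x)) column ⟩
  sum (f x) + (sum (f x) + sumWithout f x)
    ≡⟨ ℕ.+-assoc (sum (f x)) _ _ ⟨
  (sum (f x) + sum (f x)) + sumWithout f x
    ∎
  where
  open ≡-Reasoning
  column : sum (λ i → f (punchIn x i) x) ≡ sum (f x)
  column = begin
    sum (λ i → f (punchIn x i) x)          ≡⟨ sum-cong-≗ {n} (λ i → f-sym (punchIn x i) x) ⟩
    sum (λ i → f x (punchIn x i))          ≡⟨ cong (_+ sum (λ i → f x (punchIn x i))) fxx≡0 ⟨
    f x x + sum (λ i → f x (punchIn x i))  ≡⟨ sum-remove {i = x} (f x) ⟨
    sum (f x)                              ∎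

indicator : {P : Set ℓ₁} → Dec P → ℕ
indicator (yes _) = 1
indicator (no _)  = 0

indicator-cong : {P : Set ℓ₁} {Q : Set ℓ₂} → (P → Q) → (Q → P) →
  (P? : Dec P) (Q? : Dec Q) → indicator P? ≡ indicator Q?
indicator-cong P→Q Q→P (yes p) (yes q) = refl
indicator-cong P→Q Q→P (yes p) (no ¬q) = contradiction (P→Q p) ¬q
indicator-cong P→Q Q→P (no ¬p) (yes q) = contradiction (Q→P q) ¬p
indicator-cong P→Q Q→P (no ¬p) (no ¬q) = refl

#≡sum : (P? : Decidable {A = Fin n} P) → # P? ≡ sum (λ i → indicator (P? i))
#≡sum P? = go P? id
  where
  go : ∀ {m} (P? : Decidable {A = Fin n} P) (f : Fin m → Fin n) →
    length (filter P? (tabulate f)) ≡ sum (λ i → indicator (P? (f i)))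
  go {m = zero}  P? f = refl
  go {m = suc m} P? f with P? (f zero)
  ... | yes _ = cong suc (go P? (f ∘ suc))
  ... | no _  = go P? (f ∘ suc)

sumWithout-balance : ∀ (f : Fin n → Fin n → ℕ) x y → (∀ i j → f i j ≡ f j i) → (∀ i → f i i ≡ 0) →
  (sum (f x) + sum (f x)) + sumWithout f x ≡ (sum (f y) + sum (f y)) + sumWithout f y
sumWithout-balance f x y f-sym f-diag =
  trans (sym (sum-split f x f-sym (f-diag x))) (sum-split f y f-sym (f-diag y))

halve-≤ : ∀ {k l} → k + k ≤ l + l → k ≤ l
halve-≤ k+k≤l+l = ℕ.≮⇒≥ λ l<k → ℕ.<⇒≱ (ℕ.+-mono-< l<k l<k) k+k≤l+l

-- Exchanging two colors

transpose : ℕ → ℕ → ℕ → ℕ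
transpose α β γ with γ ℕ.≟ α | γ ℕ.≟ β
... | yes _ | _     = β
... | no _  | yes _ = α
... | no _  | no _  = γ

transpose-involutive : ∀ α β γ → transpose α β (transpose α β γ) ≡ γ
transpose-involutive α β γ with γ ℕ.≟ α | γ ℕ.≟ β
transpose-involutive α β γ | yes refl | _ with β ℕ.≟ γ | β ℕ.≟ β
... | yes eq | _      = eq
... | no _   | yes _  = refl
... | no _   | no β≢β = contradiction refl β≢β
transpose-involutive α β γ | no _ | yes refl with α ℕ.≟ α
... | yes _  = refl
... | no α≢α = contradiction refl α≢α
transpose-involutive α β γ | no γ≢α | no γ≢β with γ ℕ.≟ α | γ ℕ.≟ β
... | yes eq | _      = contradiction eq γ≢α
... | no _   | yes eq = contradiction eq γ≢β
... | no _   | no _   = refl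

transpose-injective : ∀ α β {γ δ} → transpose α β γ ≡ transpose α β δ → γ ≡ δ
transpose-injective α β {γ} {δ} eq = begin
  γ                                      ≡⟨ transpose-involutive α β γ ⟨
  transpose α β (transpose α β γ)        ≡⟨ cong (transpose α β) eq ⟩
  transpose α β (transpose α β δ)        ≡⟨ transpose-involutive α β δ ⟩
  δ                                      ∎
  where open ≡-Reasoning

transpose-right : ∀ α β → transpose α β β ≡ α
transpose-right α β with β ℕ.≟ α | β ℕ.≟ β
... | yes eq | _      = eq
... | no _   | yes _  = refl
... | no _   | no β≢β = contradiction refl β≢β

transpose-< : ∀ {α β γ k} → α < k → β < k → γ < k → transpose α β γ < k
transpose-< {α} {β} {γ} α<k β<k γ<k with γ ℕ.≟ α | γ ℕ.≟ β
... | yes _ | _     = β<k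
... | no _  | yes _ = α<k
... | no _  | no _  = γ<k

-- Walks of the uncolored vertex

module Walks
  (n : ℕ) (_~_ : Rel (Fin n) 0ℓ) (_~?_ : Binary.Decidable _~_)
  (~-sym : Symmetric _~_) (~-irrefl : ∀ {x} → ¬ x ~ x)
  (r : Bool → ℕ) (2≤r : ∀ i → 2 ≤ r i)
  (uncolorable : ∀ (s : Fin n → Bool) (c : Fin n → ℕ) → (∀ v → c v < r (s v)) →
                 ¬ (∀ {a b} → a ~ b → s a ≡ s b → c a ≢ c b))
  (Low : Pred (Fin n) 0ℓ) (low? : Decidable Low)
  (low-degree : ∀ {v} → Low v → # (v ~?_) ≤ r true + r false)
  (degree-≤ : ∀ v → # (v ~?_) ≤ suc (r true + r false))
  (high-independent : ∀ {a b} → a ~ b → ¬ Low a → Low b)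
  where

  V = Fin n

  private
    variable
      s s′ : V → Bool
      a b u v x y z : V

  -- Moving the hole

  Edge : (V → Bool) → V → V → Set
  Edge s a b = a ~ b × s a ≡ s b

  edge? : ∀ s a b → Dec (Edge s a b)
  edge? s a b = (a ~? b) ×-dec (s a ≟ᵇ s b)

  Edge-sym : Edge s a b → Edge s b a
  Edge-sym (a~b , eq) = ~-sym a~b , sym eq

  -- s splits the vertices into two sides with disjoint palettes of sizes r true and r false.
  -- The vertex x is the hole: it counts as uncolored and color x is a junk value, while s x is the
  -- side on which the hole currently moves.
  record Coloring (s : V → Bool) (x : V) : Set where
    field
      color  : V → ℕ
      bound  : ∀ v → color v < r (s v)
      proper : a ≢ x → b ≢ x → Edge s a b → color a ≢ color b

  open Coloring

  Agree : V → (V → Bool) → (V → Bool) → Set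
  Agree x s s′ = ∀ {v} → v ≢ x → s′ v ≡ s v

  ≔-agree : ∀ {i} → Agree x s (s [ x ≔ i ])
  ≔-agree {s = s} = ≔-other s

  0<r : ∀ i → 0 < r i
  0<r i = ℕ.≤-trans (s≤s z≤n) (2≤r i)

  -- A color absent from the same-side neighbors could be given to the hole, which would color the
  -- whole graph.
  unseen : (C : Coloring s x) → ∀ {γ} → γ < r (s x) → ¬ (∀ {b} → Edge s x b → color C b ≢ γ)
  unseen {s} {x} C {γ} γ<r γ-unseen = uncolorable s c c<r λ {a} {b} a~b eq → c-proper a b (a~b , eq)
    where
    c : V → ℕ
    c = color C [ x ≔ γ ]
    c<r : ∀ v → c v < r (s v)
    c<r v with v ≟ x
    ... | yes refl = subst (_< r (s v)) (sym (≔-same (color C) v)) γ<r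
    ... | no v≢x   = subst (_< r (s v)) (sym (≔-other (color C) v≢x)) (bound C v)
    c-proper : ∀ a b → Edge s a b → c a ≢ c b
    c-proper a b e ca≡cb with a ≟ x | b ≟ x
    ... | yes refl | yes refl = ~-irrefl (proj₁ e)
    ... | yes refl | no b≢x   =
      γ-unseen e (trans (sym (≔-other (color C) b≢x)) (trans (sym ca≡cb) (≔-same (color C) a)))
    ... | no a≢x   | yes refl =
      γ-unseen (Edge-sym e) (trans (sym (≔-other (color C) a≢x)) (trans ca≡cb (≔-same (color C) b)))
    ... | no a≢x   | no b≢x   = proper C a≢x b≢x e
      (trans (sym (≔-other (color C) a≢x)) (trans ca≡cb (≔-other (color C) b≢x)))

  sees : (C : Coloring s x) → ∀ {γ} → γ < r (s x) → ∃ λ b → Edge s x b × color C b ≡ γ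
  sees {s} {x} C {γ} γ<r with any? (λ b → edge? s x b ×-dec (color C b ℕ.≟ γ))
  ... | yes found = found
  ... | no ¬found = ⊥-elim (unseen C γ<r λ e eq → ¬found (_ , e , eq))

  d : (V → Bool) → V → ℕ
  d s x = # (edge? s x)

  Tight : (V → Bool) → V → Set
  Tight s x = d s x ≤ r (s x)

  r≤d : Coloring s x → r (s x) ≤ d s x
  r≤d {s} {x} C = surjection-≤# (edge? s x) (color C) (sees C)

  -- All `r (s x)` colors occur around the hole. If `a` and `b` shared one, all would still occur
  -- without `b`, on fewer than `r (s x)` vertices.
  distinct : (C : Coloring s x) → Tight s x → Edge s x a → Edge s x b → color C a ≡ color C b → a ≡ b
  distinct {s} {x} {a} {b} C tight ea eb ca≡cb with a ≟ b
  ... | yes a≡b = a≡b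
  ... | no a≢b = contradiction
    (ℕ.<-≤-trans (ℕ.≤-<-trans (surjection-≤# others? (color C) seen) others<d) tight) (ℕ.<-irrefl refl)
    where
    others? : Decidable (λ z → Edge s x z × z ≢ b)
    others? z = edge? s x z ×-dec ¬? (z ≟ b)
    seen : ∀ {γ} → γ < r (s x) → ∃ λ z → (Edge s x z × z ≢ b) × color C z ≡ γ
    seen γ<r with sees C γ<r
    ... | z , e , eq with z ≟ b
    ... | yes refl = a , (ea , a≢b) , trans ca≡cb eq
    ... | no z≢b   = z , (e , z≢b) , eq
    others<d : # others? < d s x
    others<d = #-mono-< others? (edge? s x) proj₁ eb (λ (_ , b≢b) → b≢b refl)

  -- The vertex `x` takes the color of `y`, which by `distinct` no other same-side neighbor of `x`
  -- has.
  recolored : (C : Coloring s x) → Tight s x → Edge s x y → Coloring s y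
  recolored {s} {x} {y} C tight e = record
    { color  = c
    ; bound  = c<r
    ; proper = λ {a} {b} → c-proper a b
    }
    where
    c : V → ℕ
    c = color C [ x ≔ color C y ]
    c<r : ∀ v → c v < r (s v)
    c<r v with v ≟ x
    ... | yes refl = subst₂ _<_ (sym (≔-same (color C) v)) (cong r (sym (proj₂ e))) (bound C y)
    ... | no v≢x   = subst (_< r (s v)) (sym (≔-other (color C) v≢x)) (bound C v)
    c-proper : ∀ a b → a ≢ y → b ≢ y → Edge s a b → c a ≢ c b
    c-proper a b a≢y b≢y ab ca≡cb with a ≟ x | b ≟ x
    ... | yes refl | yes refl = ~-irrefl (proj₁ ab)
    ... | yes refl | no b≢x   = b≢y (sym (distinct C tight e ab
      (trans (sym (≔-same (color C) a)) (trans ca≡cb (≔-other (color C) b≢x)))))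
    ... | no a≢x   | yes refl = a≢y (distinct C tight (Edge-sym ab) e
      (trans (sym (≔-other (color C) a≢x)) (trans ca≡cb (≔-same (color C) b))))
    ... | no a≢x   | no b≢x   = proper C a≢x b≢x ab
      (trans (sym (≔-other (color C) a≢x)) (trans ca≡cb (≔-other (color C) b≢x)))

  Agree-Edge : Agree x s s′ → a ≢ x → b ≢ x → Edge s′ a b → Edge s a b
  Agree-Edge agree a≢x b≢x (a~b , eq) = a~b , trans (sym (agree a≢x)) (trans eq (agree b≢x))

  Agree-sym : Agree x s s′ → Agree x s′ s
  Agree-sym agree v≢x = sym (agree v≢x)

  flipped : Coloring s x → Agree x s s′ → Coloring s′ x
  flipped {s} {x} {s′} C agree = record
    -- Even the junk color has to lie in the palette of the new side; 0 lies in both palettes.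
    { color  = color C [ x ≔ 0 ]
    ; bound  = c<r
    ; proper = λ a≢x b≢x ab eq → proper C a≢x b≢x (Agree-Edge agree a≢x b≢x ab)
        (trans (sym (≔-other (color C) a≢x)) (trans eq (≔-other (color C) b≢x)))
    }
    where
    c<r : ∀ v → (color C [ x ≔ 0 ]) v < r (s′ v)
    c<r v with v ≟ x
    ... | yes refl = subst (_< r (s′ v)) (sym (≔-same (color C) v)) (0<r _)
    ... | no v≢x   = subst₂ _<_ (sym (≔-other (color C) v≢x)) (cong r (sym (agree v≢x))) (bound C v)

  -- Colorings of minimal energy

  energy : (V → Bool) → V → ℕ
  energy s x = sumWithout (λ a b → indicator (edge? s a b)) x

  -- In an optimal coloring a move of the hole within a side cannot lower the energy, which keeps
  -- the number of same-side neighbors of the hole at its minimum r (s x).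
  record Good (s : V → Bool) (x : V) : Set where
    field
      coloring : Coloring s x
      optimal  : ∀ {s′ x′} → Coloring s′ x′ → energy s x ≤ energy s′ x′
      tight    : Tight s x

  open Good

  -- Edges at the hole are left out of the energy, so the side of the hole does not matter.
  energy-agree : Agree x s s′ → energy s x ≡ energy s′ x
  energy-agree {x} {s} {s′} agree = sumWithout-cong x λ {a} {b} a≢x b≢x → indicator-cong
    (Agree-Edge (Agree-sym {s = s} agree) a≢x b≢x) (Agree-Edge agree a≢x b≢x) (edge? s a b) (edge? s′ a b)

  -- Both totals are twice the number of same-side edges of `s`, since `energy` runs over ordered
  -- pairs.
  balance : ∀ s x y → (d s x + d s x) + energy s x ≡ (d s y + d s y) + energy s y
  balance s x y = subst₂ (λ k l → (k + k) + energy s x ≡ (l + l) + energy s y)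
    (sym (#≡sum (edge? s x))) (sym (#≡sum (edge? s y)))
    (sumWithout-balance _ x y
      (λ a b → indicator-cong Edge-sym Edge-sym (edge? s a b) (edge? s b a))
      (λ a → indicator-cong {Q = ⊥} (~-irrefl ∘ proj₁) ⊥-elim (edge? s a a) (no id)))

  -- Optimality and `balance` give `d s y ≤ d s x`. Conversely, `d s x` is at most the palette size
  -- by tightness, and `d s y` is at least that by `r≤d`. So the degrees agree, and with them the
  -- energies.
  good-hole : Good s x → Coloring s y → s x ≡ s y → Good s y
  good-hole {s} {x} {y} g C eq = record
    { coloring = C
    ; optimal  = λ C′ → ℕ.≤-trans energy-≤ (optimal g C′)
    ; tight    = ℕ.≤-trans dy≤dx (subst (d s x ≤_) (cong r eq) (tight g))
    }
    where
    dy≤dx : d s y ≤ d s x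
    dy≤dx = halve-≤ (ℕ.+-cancelʳ-≤ (energy s x) _ _ (ℕ.≤-trans
      (ℕ.+-monoʳ-≤ (d s y + d s y) (optimal g C)) (ℕ.≤-reflexive (sym (balance s x y)))))
    dx≤dy : d s x ≤ d s y
    dx≤dy = ℕ.≤-trans (tight g) (subst (_≤ d s y) (cong r (sym eq)) (r≤d C))
    energy-≤ : energy s y ≤ energy s x
    energy-≤ = ℕ.+-cancelˡ-≤ (d s y + d s y) _ _ (ℕ.≤-trans
      (ℕ.≤-reflexive (sym (balance s x y))) (ℕ.+-monoˡ-≤ (energy s x) (ℕ.+-mono-≤ dx≤dy dx≤dy)))

  good-move : Good s x → Edge s x y → Good s y
  good-move g e = good-hole g (recolored (coloring g) (tight g) e) (proj₂ e)

  sides-≤ : ∀ s x → d s x + d (s [ x ≔ not (s x) ]) x ≤ # (x ~?_)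
  sides-≤ s x = #-disjoint-+ (edge? s x) (edge? (s [ x ≔ not (s x) ]) x) (x ~?_) proj₁ proj₁
    λ {b} (x~b , sx≡sb) (_ , s̄x≡s̄b) → not-¬ refl (sym (begin
      not (s x)                          ≡⟨ ≔-same s x ⟨
      (s [ x ≔ not (s x) ]) x            ≡⟨ s̄x≡s̄b ⟩
      (s [ x ≔ not (s x) ]) b            ≡⟨ ≔-other s (λ b≡x → ~-irrefl (subst (x ~_) b≡x x~b)) ⟩
      s b                                ≡⟨ sx≡sb ⟨
      s x                                ∎))
    where open ≡-Reasoning

  r-not : ∀ i → r i + r (not i) ≡ r true + r false
  r-not true  = refl
  r-not false = ℕ.+-comm (r false) (r true)

  r≤d-other : Coloring s x → r (not (s x)) ≤ d (s [ x ≔ not (s x) ]) x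
  r≤d-other {s} {x} C = subst (λ i → r i ≤ d s̄ x) (≔-same s x) (r≤d (flipped C ≔-agree))
    where s̄ = s [ x ≔ not (s x) ]

  -- If flipped, the hole would see every color of the other side, so it has at least
  -- `r (not (s x))` neighbors there; the degree bound leaves at most `r (s x)` on its own side.
  low-tight : Coloring s x → Low x → Tight s x
  low-tight {s} {x} C low = ℕ.+-cancelʳ-≤ (r (not (s x))) _ _ (begin
    d s x + r (not (s x))                 ≤⟨ ℕ.+-monoʳ-≤ (d s x) (r≤d-other C) ⟩
    d s x + d (s [ x ≔ not (s x) ]) x     ≤⟨ sides-≤ s x ⟩
    # (x ~?_)                             ≤⟨ low-degree low ⟩
    r true + r false                      ≡⟨ r-not (s x) ⟨
    r (s x) + r (not (s x))               ∎)
    where open ℕ.≤-Reasoning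

  good-flip : Good s x → Low x → Agree x s s′ → Good s′ x
  good-flip {s} g low agree = record
    { coloring = C
    ; optimal  = λ C′ → subst (_≤ _) (energy-agree agree) (optimal g C′)
    ; tight    = low-tight C low
    }
    where C = flipped (coloring g) agree

  -- Otherwise exchange two colors on S so that two neighbours of the hole get the same color.
  no-cut : Good s x → (S : Pred V 0ℓ) → (∀ {z} → S z → s x ≡ s z) →
    (∀ {a b} → S a → b ≢ x → Edge s a b → S b) →
    Edge s x a → S a → Edge s x b → ¬ S b → ⊥
  no-cut {s} {x} {p} {q} g S S-side closed ep Sp eq ¬Sq = ¬¬-decidable S λ S? → body S?
    where
    C = coloring g
    α = color C p
    β = color C q
    body : Decidable S → ⊥
    body S? = unseen C′ (subst (α <_) (cong r (sym (proj₂ ep))) (bound C p)) free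
      where
      c : V → ℕ
      c v with S? v
      ... | yes _ = transpose α β (color C v)
      ... | no _  = color C v
      c<r : ∀ v → c v < r (s v)
      c<r v with S? v
      ... | yes Sv = transpose-< (subst (λ i → α < r i) (trans (sym (proj₂ ep)) (S-side Sv)) (bound C p))
                                 (subst (λ i → β < r i) (trans (sym (proj₂ eq)) (S-side Sv)) (bound C q))
                                 (bound C v)
      ... | no _   = bound C v
      c-proper : ∀ a b → a ≢ x → b ≢ x → Edge s a b → c a ≢ c b
      c-proper a b a≢x b≢x ab with S? a | S? b
      ... | yes _  | yes _  = proper C a≢x b≢x ab ∘ transpose-injective α β
      ... | yes Sa | no ¬Sb = contradiction (closed Sa b≢x ab) ¬Sb
      ... | no ¬Sa | yes Sb = contradiction (closed Sb a≢x (Edge-sym ab)) ¬Sa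
      ... | no _   | no _   = proper C a≢x b≢x ab
      C′ : Coloring s x
      C′ = record { color = c ; bound = c<r ; proper = c-proper _ _ }
      -- Inside `S`, `α` could only come from `β`, which around the hole only `q` has; outside `S`
      -- it would belong to `p`, which is in `S`.
      free : ∀ {b} → Edge s x b → c b ≢ α
      free {b} xb with S? b
      ... | yes Sb = λ τ≡α → ¬Sq (subst S (distinct C (tight g) xb eq
                       (transpose-injective α β (trans τ≡α (sym (transpose-right α β))))) Sb)
      ... | no ¬Sb = λ c≡α → ¬Sb (subst S (distinct C (tight g) ep xb (sym c≡α)) Sp)

  -- Color F as for the hole x and the rest as for the hole y.
  closed-without-hole : Coloring s x → Coloring s y → (F : Pred V 0ℓ) →
    ¬ F x → (∀ {a b} → F a → Edge s a b → F b) → ¬ F y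
  closed-without-hole {s} {x} {y} C C′ F ¬Fx closed Fy = ¬¬-decidable F λ F? → body F?
    where
    body : Decidable F → ⊥
    body F? = uncolorable s c c<r λ {a} {b} a~b eq → c-proper a b (a~b , eq)
      where
      c : V → ℕ
      c v with F? v
      ... | yes _ = color C v
      ... | no _  = color C′ v
      c<r : ∀ v → c v < r (s v)
      c<r v with F? v
      ... | yes _ = bound C v
      ... | no _  = bound C′ v
      c-proper : ∀ a b → Edge s a b → c a ≢ c b
      c-proper a b e with F? a | F? b
      ... | yes Fa | yes Fb = proper C (λ { refl → ¬Fx Fa }) (λ { refl → ¬Fx Fb }) e
      ... | yes Fa | no ¬Fb = contradiction (closed Fa e) ¬Fb
      ... | no ¬Fa | yes Fb = contradiction (closed Fb (Edge-sym e)) ¬Fa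
      ... | no ¬Fa | no ¬Fb = proper C′ (λ { refl → ¬Fa Fy }) (λ { refl → ¬Fb Fy }) e

  -- Otherwise the possible holes on the side of x can be colored by low = 0, high = 1.
  low-pair : Good s x → ¬ (∀ {u y} → Good s u → Good s y → s x ≡ s u → Low u → Low y →
    Edge s u y → y ≢ x → ⊥)
  low-pair {s} {x} g k = ¬¬-decidable (λ z → s x ≡ s z × Coloring s z) λ A? → body A?
    where
    body : Decidable (λ z → s x ≡ s z × Coloring s z) → ⊥
    body A? = uncolorable s c c<r λ {a} {b} a~b eq → c-proper a b (a~b , eq)
      where
      c : V → ℕ
      c v with A? v | low? v
      ... | yes _ | yes _ = 0
      ... | yes _ | no _  = 1
      ... | no _  | _     = color (coloring g) v
      c<r : ∀ v → c v < r (s v)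
      c<r v with A? v | low? v
      ... | yes _ | yes _ = 0<r _
      ... | yes _ | no _  = 2≤r _
      ... | no _  | _     = bound (coloring g) v
      good : s x ≡ s z × Coloring s z → Good s z
      good (eq , C) = good-hole g C eq
      next : s x ≡ s a × Coloring s a → Edge s a b → s x ≡ s b × Coloring s b
      next Aa e = trans (proj₁ Aa) (proj₂ e) , coloring (good-move (good Aa) e)
      absurd : s x ≡ s a × Coloring s a → s x ≡ s b × Coloring s b → Low a → Low b → ¬ Edge s a b
      absurd {a} {b} Aa Ab low-a low-b e with b ≟ x
      ... | no b≢x   = k (good Aa) (good Ab) (proj₁ Aa) low-a low-b e b≢x
      ... | yes refl = k (good Ab) (good Aa) (proj₁ Ab) low-b low-a (Edge-sym e)
                         (λ { refl → ~-irrefl (proj₁ e) })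
      A-x : s x ≡ s x × Coloring s x
      A-x = refl , coloring g
      c-proper : ∀ a b → Edge s a b → c a ≢ c b
      c-proper a b e with A? a | A? b | low? a | low? b
      ... | yes Aa | yes Ab | yes low-a | yes low-b = λ _ → absurd Aa Ab low-a low-b e
      ... | yes _  | yes _  | no ¬low-a | no ¬low-b = λ _ → ¬low-b (high-independent (proj₁ e) ¬low-a)
      ... | yes _  | yes _  | yes _     | no _      = λ ()
      ... | yes _  | yes _  | no _      | yes _     = λ ()
      ... | yes Aa | no ¬Ab | _ | _ = contradiction (next Aa e) ¬Ab
      ... | no ¬Aa | yes Ab | _ | _ = contradiction (next Ab (Edge-sym e)) ¬Aa
      ... | no ¬Aa | no ¬Ab | _ | _ = proper (coloring g) (λ { refl → ¬Aa A-x }) (λ { refl → ¬Ab A-x }) e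

  -- Take a coloring of minimal energy. A high hole has at most one neighbor more than there are
  -- colors, so it is tight on one of the two sides, and from there it moves to a neighbor, which is
  -- low.
  good-start : Coloring s x → ¬ (∀ {s y} → Good s y → Low y → ⊥)
  good-start {s₀} {x₀} C₀ k = ¬¬-minimal (λ (s , x) → Coloring s x) (λ (s , x) → energy s x) ((s₀ , x₀) , C₀)
    λ { ((s , x) , C , minimal) → start C (λ C′ → minimal _ C′) }
    where
    from-high : Good s x → ¬ Low x → ⊥
    from-high g high with sees (coloring g) (0<r _)
    ... | _ , e , _ = k (good-move g e) (high-independent (proj₁ e) high)
    start : Coloring s x → (∀ {s′ x′} → Coloring s′ x′ → energy s x ≤ energy s′ x′) → ⊥
    start {s} {x} C minimal with low? x
    ... | yes low = k (record { coloring = C ; optimal = minimal ; tight = low-tight C low }) low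
    ... | no high with d s x ℕ.≤? r (s x)
    ... | yes tight = from-high (record { coloring = C ; optimal = minimal ; tight = tight }) high
    ... | no ¬tight = from-high (record
      { coloring = flipped C ≔-agree
      ; optimal  = λ C′ → subst (_≤ _) (energy-agree {s = s} ≔-agree) (minimal C′)
      ; tight    = subst (λ i → d s̄ x ≤ r i) (sym (≔-same s x)) d̄≤r̄
      }) high
      where
      s̄ = s [ x ≔ not (s x) ]
      d̄≤r̄ : d s̄ x ≤ r (not (s x))
      d̄≤r̄ = ℕ.+-cancelˡ-≤ (suc (r (s x))) _ _ (begin
        suc (r (s x)) + d s̄ x           ≤⟨ ℕ.+-monoˡ-≤ (d s̄ x) (ℕ.≰⇒> ¬tight) ⟩
        d s x + d s̄ x                   ≤⟨ sides-≤ s x ⟩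
        # (x ~?_)                       ≤⟨ degree-≤ x ⟩
        suc (r true + r false)          ≡⟨ cong suc (r-not (s x)) ⟨
        suc (r (s x) + r (not (s x)))   ∎)
        where open ℕ.≤-Reasoning

  -- For a hole y, the other vertices of its component on its side.
  Comp : (V → Bool) → V → Pred V 0ℓ
  Comp s y z = Coloring s z × s y ≡ s z × z ≢ y

  comp-good : Good s y → Comp s y z → Good s z
  comp-good g (C , eq , _) = good-hole g C eq

  comp-step : Good s y → Comp s y a → Edge s a b → b ≢ y → Comp s y b
  comp-step g A@(_ , eq , _) e b≢y =
    coloring (good-move (comp-good g A) e) , trans eq (proj₂ e) , b≢y

  -- At a later hole v, what was left of the component of y is intact, and v attaches to it.
  record Return (s : V → Bool) (y : V) (s′ : V → Bool) (v : V) : Set where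
    field
      good    : Good s y
      good′   : Good s′ v
      side    : s′ v ≡ s y
      inside  : Comp s y z → s y ≡ s′ z
      outside : ¬ Comp s y v
      closed  : Comp s y a → b ≢ v → Edge s′ a b → Comp s y b
      {entry} : V
      entry∈  : Comp s y entry
      v~entry : v ~ entry

  -- Neighborhoods after a return

  module _ (R : Return s y s′ v) where
    open Return R

    -- By `no-cut` the same-side neighbors of `v` all lie in the component, since `entry` does. If
    -- such a `z` were not adjacent to `y`, it would keep its same-side neighbors and gain `v`,
    -- which is too many for a vertex to which the hole can move.
    return-⊆ : v ~ z → s y ≡ s′ z → y ~ z
    return-⊆ {z = z} v~z sy≡s′z = decidable-stable (y ~? z) λ y≁z →
      no-cut good′ (Comp s y) (λ A → trans side (inside A)) closed
        (v~entry , trans side (inside entry∈)) entry∈ (v~z , trans side sy≡s′z) λ A →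
      let
        v∉ : ¬ Edge s z v
        v∉ = λ e → outside (comp-step good A e λ { refl → y≁z v~z })
        ⊆ : Edge s z b → Edge s′ z b
        ⊆ = λ { (z~b , eq) → z~b , trans (sym sy≡s′z)
                  (inside (comp-step good A (z~b , eq) λ { refl → y≁z (~-sym z~b) })) }
        d<d′ : d s z < d s′ z
        d<d′ = #-mono-< (edge? s z) (edge? s′ z) ⊆ (~-sym v~z , trans (sym sy≡s′z) (sym side)) v∉
        d′≤d : d s′ z ≤ d s z
        d′≤d = ℕ.≤-trans
          (subst (λ i → d s′ z ≤ r i) (trans (sym sy≡s′z) (proj₁ (proj₂ A)))
            (tight (good-move good′ (v~z , trans side sy≡s′z))))
          (r≤d (proj₁ A))
      in ℕ.<⇒≱ d<d′ d′≤d

    -- The same-side neighbors of `v` are among those of `y`. There are at least `r (s y)` of the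
    -- former and at most as many of the latter, so the two sets coincide.
    return-⊇ : Edge s y z → v ~ z
    return-⊇ {z = z} e = decidable-stable (v ~? z) λ v≁z → ℕ.<⇒≱
      (#-mono-< (edge? s′ v) (edge? s y) v⊆y e (v≁z ∘ proj₁))
      (ℕ.≤-trans (tight good) (subst (λ i → r i ≤ d s′ v) side (r≤d (coloring good′))))
      where
      v⊆y : Edge s′ v b → Edge s y b
      v⊆y {b} (v~b , eq) with sy≡s′b ← trans (sym side) eq = y~b , decidable-stable (s y ≟ᵇ s b) λ sy≢sb →
        no-cut good′ (Comp s y) (λ A → trans side (inside A)) closed
          (v~entry , trans side (inside entry∈)) entry∈ (v~b , eq) (sy≢sb ∘ proj₁ ∘ proj₂)
        where
        y~b : y ~ b
        y~b = return-⊆ v~b sy≡s′b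

  -- Changing sides and returning at once

  swing : (V → Bool) → V → V → Bool
  swing s y = s [ y ≔ not (s y) ]

  swing-good : Good s y → Low y → Good (swing s y) y
  swing-good g low = good-flip g low ≔-agree

  swing-hole : ∀ s y → swing s y y ≡ not (s y)
  swing-hole s y = ≔-same s y

  swing-other : ∀ s → z ≢ y → swing s y z ≡ s z
  swing-other s = ≔-other s

  swing-comp-side : ∀ s → Comp (swing s y) y v → s v ≡ not (s y)
  swing-comp-side {y} s (_ , eq , v≢y) = trans (sym (swing-other s v≢y)) (trans (sym eq) (swing-hole s y))

  opposite : ∀ {i j : Bool} → j ≡ not i → i ≢ j
  opposite eq i≡j = not-¬ (sym i≡j) eq

  -- The hole changes sides at `y`, travels to `v` and changes back there. Only `y` and `v` end on
  -- new sides, so the rest of the component of `y` is intact.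
  immediate-return : Good s y → Low y → Low v → Comp (swing s y) y v → Comp s y z → v ~ z →
    Return s y (swing s y [ v ≔ s y ]) v
  immediate-return {s} {y} {v} g low-y low-v B A v~z = record
    { good    = g
    ; good′   = good-flip (comp-good (swing-good g low-y) B) low-v ≔-agree
    ; side    = ≔-same (swing s y) v
    ; inside  = λ (_ , eq , z≢y) → trans eq (sym (σ-other (λ { refl → sy≢sv eq }) z≢y))
    ; outside = λ (_ , eq , _) → sy≢sv eq
    ; closed  = λ {a} {b} A@(_ , eq , a≢y) b≢v (a~b , eq′) →
        let sy≡σb = trans eq (trans (sym (σ-other (λ { refl → sy≢sv eq }) a≢y)) eq′)
            b≢y    = λ { refl → opposite σy sy≡σb }
        in comp-step g A (a~b , trans (sym eq) (trans sy≡σb (σ-other b≢v b≢y))) b≢y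
    ; entry∈  = A
    ; v~entry = v~z
    }
    where
    σ = swing s y [ v ≔ s y ]
    v≢y : v ≢ y
    v≢y = proj₂ (proj₂ B)
    sy≢sv : s y ≢ s v
    sy≢sv = opposite (swing-comp-side s B)
    σ-other : z ≢ v → z ≢ y → σ z ≡ s z
    σ-other z≢v z≢y = trans (≔-other (swing s y) z≢v) (swing-other s z≢y)
    σy : σ y ≡ not (s y)
    σy = trans (≔-other (swing s y) (v≢y ∘ sym)) (swing-hole s y)

  module _ (R : Return s y s′ v) (v≢y : v ≢ y) (low-v : Low v) (e : Edge s y u) (low-u : Low u) where
    open Return R

    private
      v~u : v ~ u
      v~u = return-⊇ R e

      u≢v : u ≢ v
      u≢v refl = ~-irrefl v~u

      good-u : Good s u
      good-u = good-move good e

      sv : s v ≡ not (s u)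
      -- Otherwise the hole could move from `u` to `v` within its side, and `v` would belong to the
      -- component.
      sv = ¬-not λ sv≡su → outside
        (coloring (good-move good-u (~-sym v~u , sym sv≡su)) , trans (proj₂ e) (sym sv≡su) , v≢y)

      in-swing : Comp (swing s u) u v
      in-swing = coloring (good-move (swing-good good-u low-u) (~-sym v~u , eq)) , eq , u≢v ∘ sym
        where
        eq : swing s u u ≡ swing s u v
        eq = trans (swing-hole s u) (trans (sym sv) (sym (swing-other s (u≢v ∘ sym))))

    -- The other route: the hole moves from u directly to v on the opposite side.
    return-u : Return s u (swing s u [ v ≔ s u ]) v
    -- Each palette has two colors, so `y` has a same-side neighbor `p` other than `u`, which serves
    -- as the entry.
    return-u with fresh (edge? s y) (u ∷ []) (ℕ.≤-trans (2≤r _) (r≤d (coloring good)))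
    ... | p , ep , p∉ = immediate-return good-u low-u low-v in-swing
            (coloring (good-move good ep) , trans (sym (proj₂ e)) (proj₂ ep) , p∉ ∘ here) (return-⊇ R ep)

    return-side : s v ≡ not (s u)
    return-side = sv

    return-~ : v ~ y
    return-~ = return-⊇ return-u (Edge-sym e)

  module ImmediateReturn {s u y v p}
    (g : Good s u) (low-u : Low u) (low-y : Low y) (e : Edge s u y)
    (low-v : Low v) (B : Comp (swing s y) y v) (A : Comp s y p) (v~p : v ~ p) where

    private
      v≢y = proj₂ (proj₂ B)
      good-y = good-move g e
      R = immediate-return good-y low-y low-v B A v~p
      R′ = return-u R v≢y low-v (Edge-sym e) low-u

      u≢y : u ≢ y
      u≢y refl = ~-irrefl (proj₁ e)

    v~u : v ~ u
    v~u = return-⊇ R (Edge-sym e)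

    v~y : v ~ y
    v~y = return-~ R v≢y low-v (Edge-sym e) low-u

    sv : s v ≡ not (s u)
    sv = return-side R v≢y low-v (Edge-sym e) low-u

    private
      -- Flipped instead of `y`, the hole `u` meets on the other side the component of the flipped
      -- `y`, attached through `v`.
      R″ : Return (swing s y) y (swing s u) u
      R″ = record
        { good    = swing-good good-y low-y
        ; good′   = swing-good g low-u
        ; side    = sides
        ; inside  = λ (_ , eq , z≢y) → let sz = trans eq (swing-other s z≢y) in
            trans sz (sym (swing-other s (λ { refl → opposite (swing-hole s y) (trans (sym (proj₂ e)) (sym sz)) })))
        ; outside = λ (_ , eq , _) → opposite (swing-hole s y)
            (trans (sym (proj₂ e)) (trans (sym (swing-other s u≢y)) (sym eq)))
        ; closed  = λ {a} {b} A@(_ , eq , a≢y) b≢u (a~b , eq′) →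
            let sa  = trans eq (swing-other s a≢y)
                a≢u = λ { refl → opposite (swing-hole s y) (trans (sym (proj₂ e)) (sym sa)) }
                sb  = trans sa (trans (sym (swing-other s a≢u)) (trans eq′ (swing-other s b≢u)))
                b≢y = λ { refl → opposite (swing-hole s y) (sym sb) }
            in comp-step (swing-good good-y low-y) A (a~b , trans (sym eq) (trans sb (sym (swing-other s b≢y)))) b≢y
        ; entry∈  = B
        ; v~entry = ~-sym v~u
        }
        where
        sides : swing s u u ≡ swing s y y
        sides = trans (swing-hole s u) (trans (cong not (proj₂ e)) (sym (swing-hole s y)))

    -- A neighbor on the side of `u` is passed to `v` by `R′` and from there to `y` by `R`; one on
    -- the other side is passed directly by `R″`.
    dominates : u ~ z → z ≢ y → y ~ z
    dominates {z} u~z z≢y with s u ≟ᵇ s z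
    ... | yes eq = return-⊆ R (return-⊇ R′ (u~z , eq))
                     (trans (sym (proj₂ e)) (trans eq (sym (trans
                       (≔-other (swing s y) (λ { refl → opposite sv eq })) (swing-other s z≢y)))))
    ... | no neq = return-⊆ R″ u~z (begin
      swing s y y  ≡⟨ swing-hole s y ⟩
      not (s y)    ≡⟨ cong not (proj₂ e) ⟨
      not (s u)    ≡⟨ ¬-not (neq ∘ sym) ⟨
      s z          ≡⟨ swing-other s (λ { refl → ~-irrefl u~z }) ⟨
      swing s u z  ∎)
      where open ≡-Reasoning

  -- Three twins

  record Triple : Set where
    field
      {x₁ x₂ x₃} : V
      low₁ : Low x₁
      low₂ : Low x₂
      low₃ : Low x₃
      x₁~x₂ : x₁ ~ x₂
      x₁~x₃ : x₁ ~ x₃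
      x₂~x₃ : x₂ ~ x₃
      dominates₂ : x₁ ~ z → z ≢ x₂ → x₂ ~ z
      dominates₃ : x₁ ~ z → z ≢ x₃ → x₃ ~ z

  -- After u → y → v the hole can go back to u, which is an immediate return for the pair y, v.
  triple : ∀ {p} → Good s u → Low u → Low y → Edge s u y → Low v →
    Comp (swing s y) y v → Comp s y p → v ~ p → Triple
  triple {s} {u} {y} {v} g low-u low-y e low-v B A v~p = record
    { low₁ = low-u ; low₂ = low-y ; low₃ = low-v
    ; x₁~x₂ = proj₁ e ; x₁~x₃ = ~-sym v~u ; x₂~x₃ = ~-sym v~y
    ; dominates₂ = dominates
    ; dominates₃ = λ {z} u~z z≢v → case-y z u~z z≢v
    }
    where
    open ImmediateReturn g low-u low-y e low-v B A v~p
    good-y : Good (swing s y) y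
    good-y = swing-good (good-move g e) low-y
    s₁ = swing s y
    s₂ = swing s₁ v
    u≢v : u ≢ v
    u≢v refl = ~-irrefl v~u
    u≢y : u ≢ y
    u≢y refl = ~-irrefl (proj₁ e)
    vu : Edge s₂ v u
    vu = v~u , (begin
      s₂ v            ≡⟨ swing-hole s₁ v ⟩
      not (s₁ v)      ≡⟨ cong not (swing-other s (proj₂ (proj₂ B))) ⟩
      not (s v)       ≡⟨ cong not sv ⟩
      not (not (s u)) ≡⟨ not-involutive (s u) ⟩
      s u             ≡⟨ swing-other s u≢y ⟨
      s₁ u            ≡⟨ swing-other s₁ u≢v ⟨
      s₂ u            ∎)
      where open ≡-Reasoning
    module Back = ImmediateReturn {s = s₁} {u = y} {y = v} {v = u} {p = y} good-y low-y low-v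
      (~-sym v~y , proj₁ (proj₂ B)) low-u
      (coloring (good-move (swing-good (comp-good good-y B) low-v) vu) , proj₂ vu , u≢v)
      (coloring good-y , sym (proj₁ (proj₂ B)) , proj₂ (proj₂ B) ∘ sym) (proj₁ e)
    case-y : ∀ z → u ~ z → z ≢ v → v ~ z
    case-y z u~z z≢v with z ≟ y
    ... | yes refl = v~y
    ... | no z≢y   = Back.dominates (dominates u~z z≢y) z≢v

  -- P is what remains of a component on side i after the removal of y.
  Piece : Pred V 0ℓ → V → Bool → Set
  Piece P y i = ∀ {s v p} → Good s v → Low v → s v ≡ i → v ≢ y →
    (∀ {z} → P z → i ≡ s z) → ¬ P v → (∀ {a b} → P a → b ≢ v → Edge s a b → P b) →
    P p → v ~ p → v ~ y

  comp-piece : Good s u → Low u → Edge s u y → Piece (Comp s y) y (s y)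
  comp-piece g low-u e g′ low-v side v≢y inside outside closed A v~p =
    return-~ (record
      { good = good-move g e ; good′ = g′ ; side = side ; inside = inside ; outside = outside
      ; closed = closed ; entry∈ = A ; v~entry = v~p }) v≢y low-v (Edge-sym e) low-u

  -- The hole x is about to enter the side s x. N is the component that it left behind on the
  -- other side, and F the union of the components left at earlier steps; each of them is
  -- remembered with the vertex y that was removed from it.
  record Frozen (s : V → Bool) (x : V) (F N : Pred V 0ℓ) : Set₁ where
    field
      good     : Good s x
      low      : Low x
      x∉F      : ¬ F x
      pieces   : F z → ∃₂ λ (P : Pred V 0ℓ) y →
        P z × (∀ {a} → P a → F a) × (∀ {a} → P a → s z ≡ s a) ×
        (∀ {a b} → P a → Edge s a b → P b) × Piece P y (s z) × s y ≡ not (s z) × (F y ⊎ N y)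
      N-side   : N z → s z ≡ not (s x)
      N-closed : N a → Edge s a b → N b
      N-piece  : Piece N x (not (s x))
      N-return : Low v → Coloring s v → s x ≡ s v → v ≢ x → N z → v ~ z → Triple

  -- One step of the walk

  module Step {s x F N} (fr : Frozen s x F N) (¬triple : ¬ Triple) where
    open Frozen fr

    F-closed : F a → Edge s a b → F b
    F-closed Fa e with pieces Fa
    ... | _ , _ , Pa , P⊆F , _ , P-closed , _ = P⊆F (P-closed Pa e)

    -- The set `F` is closed and avoids the hole `x`, so `closed-without-hole` keeps other holes out
    -- of it; `N` lies on the other side.
    not-frozen : Good s y → s x ≡ s y → ¬ (F y ⊎ N y)
    not-frozen g eq (inj₁ Fy) = closed-without-hole (coloring good) (coloring g) F x∉F F-closed Fy
    not-frozen g eq (inj₂ Ny) = opposite (N-side Ny) eq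

    module _ (g-u : Good s u) (g-y : Good s y) (sx≡su : s x ≡ s u) (low-u : Low u) (low-y : Low y)
             (e : Edge s u y) (y≢x : y ≢ x) where

      private
        s₁ : V → Bool
        s₁ = swing s y

        sx≡sy : s x ≡ s y
        sx≡sy = trans sx≡su (proj₂ e)

        y∉ : ¬ (F y ⊎ N y)
        y∉ = not-frozen g-y sx≡sy

        s₁-frozen : F z ⊎ N z → s₁ z ≡ s z
        s₁-frozen FNz = swing-other s λ { refl → y∉ FNz }

        -- An edge into `N` is an immediate return and gives a `Triple`. An edge into `F` on the
        -- side of `y` puts `y` in `F`. An edge into a piece on the other side makes `y` adjacent to
        -- the vertex `y′` removed from that piece; `y′` is on the side of `y`, hence in `F` and not
        -- in `N`, which again puts `y` in `F`.
        y-apart : F z ⊎ N z → ¬ y ~ z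
        y-apart (inj₂ Nz) y~z = ¬triple (N-return low-y (coloring g-y) sx≡sy y≢x Nz y~z)
        y-apart {z} (inj₁ Fz) y~z with s z ≟ᵇ s y
        ... | yes sz≡sy = y∉ (inj₁ (F-closed Fz (~-sym y~z , sz≡sy)))
        ... | no sz≢sy with pieces Fz
        ... | P , y′ , Pz , P⊆F , P-side , P-closed , piece , sy′ , FNy′ =
          not-here FNy′
          where
          sz : s z ≡ not (s y)
          sz = ¬-not sz≢sy
          sy′≡sy : s y′ ≡ s y
          sy′≡sy = trans sy′ (trans (cong not sz) (not-involutive (s y)))
          not-here : ¬ (F y′ ⊎ N y′)
          not-here (inj₂ Ny′) = opposite (N-side Ny′) (trans sx≡sy (sym sy′≡sy))
          not-here (inj₁ Fy′) = y∉ (inj₁ (F-closed Fy′ (~-sym y~y′ , sy′≡sy)))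
            where
            P-s₁ : ∀ {a} → P a → s₁ a ≡ s a
            P-s₁ Pa = s₁-frozen (inj₁ (P⊆F Pa))
            y~y′ : y ~ y′
            y~y′ = piece (swing-good g-y low-y) low-y (trans (swing-hole s y) (sym sz))
              (λ { refl → y∉ (inj₁ Fy′) })
              (λ Pa → trans (P-side Pa) (sym (P-s₁ Pa)))
              (λ Py → y∉ (inj₁ (P⊆F Py)))
              (λ Pa b≢y (a~b , eq) → P-closed Pa (a~b , trans (sym (P-s₁ Pa)) (trans eq (swing-other s b≢y))))
              Pz y~z

        lift-closed : {P : Pred V 0ℓ} → (∀ {a} → P a → F a ⊎ N a) →
          (∀ {a b} → P a → Edge s a b → P b) → ∀ {a b} → P a → Edge s₁ a b → P b
        lift-closed P⊆ P-closed Pa (a~b , eq) = P-closed Pa (a~b , trans (sym (s₁-frozen (P⊆ Pa)))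
          (trans eq (swing-other s λ { refl → y-apart (P⊆ Pa) (~-sym a~b) })))

        x∈ : Comp s y x
        x∈ = coloring good , sym sx≡sy , y≢x ∘ sym

      u∈ : Comp s y u
      u∈ = coloring g-u , sym (proj₂ e) , λ { refl → ~-irrefl (proj₁ e) }

      next : Frozen (swing s y) y (λ z → F z ⊎ N z) (Comp s y)
      next = record
        { good     = swing-good g-y low-y
        ; low      = low-y
        ; x∉F      = y∉
        ; pieces   = new-pieces
        ; N-side   = comp-side
        ; N-closed = λ {a} {b} A@(_ , eq , a≢y) (a~b , eq′) →
            let s₁b = trans (sym eq′) (trans (swing-other s a≢y) (sym eq))
                b≢y = λ { refl → opposite (swing-hole s y) (sym s₁b) }
            in comp-step g-y A (a~b , trans (sym eq) (trans (sym s₁b) (swing-other s b≢y))) b≢y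
        ; N-piece  = subst (Piece (Comp s y) y) sy≡ (comp-piece g-u low-u e)
        ; N-return = λ low-v C eq v≢y A v~z → triple g-u low-u low-y e low-v (C , eq , v≢y) A v~z
        }
        where
        sy≡ : s y ≡ not (s₁ y)
        sy≡ = sym (trans (cong not (swing-hole s y)) (not-involutive (s y)))
        comp-side : Comp s y z → s₁ z ≡ not (s₁ y)
        comp-side (_ , eq , z≢y) = trans (swing-other s z≢y) (trans (sym eq) sy≡)
        new-pieces : F z ⊎ N z → ∃₂ λ (P : Pred V 0ℓ) y′ →
          P z × (∀ {a} → P a → F a ⊎ N a) × (∀ {a} → P a → s₁ z ≡ s₁ a) ×
          (∀ {a b} → P a → Edge s₁ a b → P b) × Piece P y′ (s₁ z) × s₁ y′ ≡ not (s₁ z) ×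
          ((F y′ ⊎ N y′) ⊎ Comp s y y′)
        new-pieces (inj₁ Fz) with pieces Fz
        ... | P , y′ , Pz , P⊆F , P-side , P-closed , piece , sy′ , FNy′ =
          P , y′ , Pz , inj₁ ∘ P⊆F ,
          (λ Pa → trans s₁z (trans (P-side Pa) (sym (s₁-frozen (inj₁ (P⊆F Pa)))))) ,
          lift-closed (inj₁ ∘ P⊆F) P-closed ,
          subst (Piece P y′) (sym s₁z) piece ,
          trans (s₁-frozen FNy′) (trans sy′ (cong not (sym s₁z))) ,
          inj₁ FNy′
          where s₁z = s₁-frozen (inj₁ Fz)
        -- The old `N` becomes one more piece. The vertex removed from it is the old hole `x`, which
        -- lies in the component now being left.
        new-pieces (inj₂ Nz) =
          N , x , Nz , inj₂ ,
          (λ Na → trans s₁z (sym (trans (s₁-frozen (inj₂ Na)) (N-side Na)))) ,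
          lift-closed inj₂ N-closed ,
          subst (Piece N x) (sym s₁z) N-piece ,
          trans (swing-other s (y≢x ∘ sym)) (trans (sym (not-involutive (s x))) (cong not (sym s₁z))) ,
          inj₂ x∈
          where s₁z = trans (s₁-frozen (inj₂ Nz)) (N-side Nz)

  -- Every step freezes a new vertex, so the walk ends.
  walk : ¬ Triple → ∀ fuel {s x F N} zs → Unique zs → All (λ z → F z ⊎ N z) zs →
    n < length zs + fuel → ¬ Frozen s x F N
  walk ¬triple zero zs zs! _ n<0 _ = ℕ.<⇒≱ n<0 (ℕ.≤-trans (ℕ.≤-reflexive (ℕ.+-identityʳ _)) (length-≤ zs!))
  walk ¬triple (suc fuel) {s} zs zs! frozen n< fr = low-pair (Frozen.good fr)
    λ {u} {y} g-u g-y sx≡su low-u low-y e y≢x → walk ¬triple fuel (u ∷ zs)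
      (All.map (λ FNz → λ { refl → not-frozen g-u sx≡su FNz }) frozen ∷ zs!)
      (inj₂ (u∈ g-u g-y sx≡su low-u low-y e y≢x) ∷ All.map inj₁ frozen)
      (subst (n <_) (ℕ.+-suc (length zs) fuel) n<)
      (next g-u g-y sx≡su low-u low-y e y≢x)
    where open Step fr ¬triple

  exists-triple : Coloring s x → ¬ ¬ Triple
  exists-triple C ¬triple = good-start C λ g low →
    -- Nothing is frozen at first, and at most `n` vertices can ever be, so fuel `suc n` suffices.
    walk ¬triple (suc n) {F = λ _ → ⊥} {N = λ _ → ⊥} [] [] [] ℕ.≤-refl (record
    { good = g ; low = low ; x∉F = id ; pieces = λ () ; N-side = λ ()
    ; N-closed = λ () ; N-piece = λ _ _ _ _ _ _ _ () ; N-return = λ _ _ _ _ () })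

-- Recoloring around three twins

module Recoloring
  (n : ℕ) (_~_ : Rel (Fin n) 0ℓ) (_~?_ : Binary.Decidable _~_)
  (~-sym : Symmetric _~_) (~-irrefl : ∀ {x} → ¬ x ~ x)
  (k : ℕ) (5≤k : 5 ≤ k)
  (uncolorable : ∀ (c : Fin n → ℕ) → (∀ v → c v < k) → ¬ (∀ {a b} → a ~ b → c a ≢ c b))
  (colorable-off : ∀ x → ∃ λ (c : Fin n → ℕ) → (∀ v → c v < k) ×
                   (∀ {a b} → a ≢ x → b ≢ x → a ~ b → c a ≢ c b))
  (degree-≤ : ∀ v → # (v ~?_) ≤ suc k)
  (high-independent : ∀ {a b} → a ~ b → ¬ # (a ~?_) ≤ k → # (b ~?_) ≤ k)
  where

  V = Fin n

  private
    variable
      a b q t u v w x y z : V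
      κ : V → ℕ

  Low : Pred V 0ℓ
  Low v = # (v ~?_) ≤ k

  low? : Decidable Low
  low? v = # (v ~?_) ℕ.≤? k

  ColoringOff : Pred V 0ℓ → (V → ℕ) → Set
  ColoringOff D c = (∀ v → c v < k) × (∀ {a b} → ¬ D a → ¬ D b → a ~ b → c a ≢ c b)

  -- With `E` equal to `D` this changes the color of `a`; with `E` equal to `D` without `a` it
  -- colors `a` for the first time.
  recolor : ∀ {D E γ} → ColoringOff D κ → (∀ {z} → ¬ E z → z ≢ a → ¬ D z) →
    γ < k → (∀ {z} → a ~ z → ¬ E z → κ z ≢ γ) → ColoringOff E (κ [ a ≔ γ ])
  recolor {κ = c} {a} {D} {E} {γ} (c<k , proper) D⊆ γ<k free = bound , λ {u} {v} → proper′ u v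
    where
    bound : ∀ v → (c [ a ≔ γ ]) v < k
    bound v with v ≟ a
    ... | yes refl = subst (_< k) (sym (≔-same c v)) γ<k
    ... | no v≢a   = subst (_< k) (sym (≔-other c v≢a)) (c<k v)
    proper′ : ∀ u v → ¬ E u → ¬ E v → u ~ v → (c [ a ≔ γ ]) u ≢ (c [ a ≔ γ ]) v
    proper′ u v ¬Eu ¬Ev u~v eq with u ≟ a | v ≟ a
    ... | yes refl | yes refl = ~-irrefl u~v
    ... | yes refl | no v≢a   = free u~v ¬Ev (trans (sym (≔-other c v≢a)) (trans (sym eq) (≔-same c u)))
    ... | no u≢a   | yes refl = free (~-sym u~v) ¬Eu (trans (sym (≔-other c u≢a)) (trans eq (≔-same c v)))
    ... | no u≢a   | no v≢a   = proper (D⊆ ¬Eu u≢a) (D⊆ ¬Ev v≢a) u~v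
      (trans (sym (≔-other c u≢a)) (trans eq (≔-other c v≢a)))

  -- A low vertex with two equally colored neighbors has a free color, so D can be colored greedily.
  greedy : ∀ m {D} (D? : Decidable D) → # D? ≤ m → a ≢ b → ¬ D a → ¬ D b →
    (∀ {w} → D w → Low w × w ~ a × w ~ b) → ColoringOff D κ → κ a ≢ κ b
  greedy {a = a} {b} {κ = c} m {D} D? #≤m a≢b ¬Da ¬Db D-low C ca≡cb with any? D?
  ... | no D-empty = uncolorable c (proj₁ C) (proj₂ C (D-empty ∘ (_ ,_)) (D-empty ∘ (_ ,_)))
  ... | yes (w , Dw) = extend m #≤m
    where
    rest? : Decidable (λ z → D z × z ≢ w)
    rest? z = D? z ×-dec ¬? (z ≟ w)
    rest<D : # rest? < # D?
    rest<D = #-mono-< rest? D? proj₁ Dw λ (_ , w≢w) → w≢w refl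
    others? : Decidable (λ z → w ~ z × z ≢ b)
    others? z = (w ~? z) ×-dec ¬? (z ≟ b)
    a≢w : a ≢ w
    a≢w refl = ¬Da Dw
    b≢w : b ≢ w
    b≢w refl = ¬Db Dw
    extend : ∀ m → # D? ≤ m → ⊥
    extend zero    #≤m = contradiction rest<D (ℕ.≤⇒≯ (ℕ.≤-trans #≤m z≤n))
    extend (suc m) #≤m = ℕ.<⇒≱
      (#-mono-< others? (w ~?_) proj₁ (proj₂ (proj₂ (D-low Dw))) λ (_ , b≢b) → b≢b refl)
      (ℕ.≤-trans (proj₁ (D-low Dw)) (surjection-≤# others? c seen))
      where
      seen : ∀ {γ} → γ < k → ∃ λ z → (w ~ z × z ≢ b) × c z ≡ γ
      -- Neighbors in `D` with junk colors count as well, since only the number of neighbors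
      -- matters. A color found at `b` is found at `a` too.
      seen {γ} γ<k with any? (λ z → (w ~? z) ×-dec (c z ℕ.≟ γ))
      ... | no unseen = ⊥-elim (greedy m rest? (s≤s⁻¹ (ℕ.≤-trans rest<D #≤m)) a≢b
              (¬Da ∘ proj₁) (¬Db ∘ proj₁) (D-low ∘ proj₁)
              (recolor C (λ ¬rest z≢w Dz → ¬rest (Dz , z≢w)) γ<k λ w~z _ cz≡γ → unseen (_ , w~z , cz≡γ))
              (trans (≔-other c a≢w) (trans ca≡cb (sym (≔-other c b≢w)))))
      ... | yes (z , w~z , cz≡γ) with z ≟ b
      ... | yes refl = a , (proj₁ (proj₂ (D-low Dw)) , a≢b) , trans ca≡cb cz≡γ
      ... | no z≢b   = z , (w~z , z≢b) , cz≡γ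

  greedy′ : ∀ {D} (D? : Decidable D) → a ≢ b → ¬ D a → ¬ D b →
    (∀ {w} → D w → Low w × w ~ a × w ~ b) → ColoringOff D κ → κ a ≢ κ b
  greedy′ D? = greedy (# D?) D? ℕ.≤-refl

  degree-≥ : ∀ v → k ≤ # (v ~?_)
  degree-≥ v with colorable-off v
  ... | c , c<k , proper = surjection-≤# (v ~?_) c seen
    where
    seen : ∀ {γ} → γ < k → ∃ λ z → v ~ z × c z ≡ γ
    seen {γ} γ<k with any? (λ z → (v ~? z) ×-dec (c z ℕ.≟ γ))
    ... | yes found = found
    ... | no unseen = ⊥-elim (uncolorable (c [ v ≔ γ ]) (proj₁ C′) (proj₂ C′ id id))
      where
      C′ : ColoringOff (λ _ → ⊥) (c [ v ≔ γ ])
      C′ = recolor {D = _≡ v} (c<k , λ u≢v w≢v → proper u≢v w≢v) (λ _ z≢v → z≢v) γ<k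
             λ v~z _ cz≡γ → unseen (_ , v~z , cz≡γ)

  -- The closed neighborhood of `x` is a clique on more than `k` vertices and misses `w`, but the
  -- graph without `w` is `k`-colorable.
  clique-dominates : ∀ x → (∀ {a b} → x ~ a → x ~ b → a ≢ b → ¬ ¬ a ~ b) →
    ∀ {w} → w ≢ x → ¬ ¬ x ~ w
  clique-dominates x clique {w} w≢x x≁w with colorable-off w
  ... | c , c<k , proper = ℕ.<⇒≱ (ℕ.≤-trans (s≤s (degree-≥ x)) (injective⇒≤ {f = f} f-injective)) ℕ.≤-refl
    where
    members : List V
    members = x ∷ elements (x ~?_)
    member : ∀ {z} → z ∈ members → z ≡ x ⊎ x ~ z
    member (here z≡x)  = inj₁ z≡x
    member (there z∈)  = inj₂ (∈-elements⁻ (x ~?_) z∈)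
    ≢w : z ≡ x ⊎ x ~ z → z ≢ w
    ≢w (inj₁ refl) refl = w≢x refl
    ≢w (inj₂ x~w)  refl = x≁w x~w
    adjacent : a ≡ x ⊎ x ~ a → b ≡ x ⊎ x ~ b → a ≢ b → ¬ ¬ a ~ b
    adjacent (inj₁ refl) (inj₁ refl) a≢b _   = a≢b refl
    adjacent (inj₁ refl) (inj₂ x~b)  a≢b a≁b = a≁b x~b
    adjacent (inj₂ x~a)  (inj₁ refl) a≢b a≁b = a≁b (~-sym x~a)
    adjacent (inj₂ x~a)  (inj₂ x~b)  a≢b a≁b = clique x~a x~b a≢b a≁b
    members! : Unique members
    members! = All.tabulate (λ z∈ → λ { refl → ~-irrefl (∈-elements⁻ (x ~?_) z∈) }) ∷ elements! (x ~?_)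
    f : Fin (length members) → Fin k
    f i = fromℕ< (c<k (lookup members i))
    f-injective : ∀ {i j} → f i ≡ f j → i ≡ j
    f-injective {i} {j} eq = Unique-lookup-injective members! (decidable-stable (_ ≟ _) λ neq →
      adjacent (member (∈-lookup i)) (member (∈-lookup j)) neq λ adj →
      proper (≢w (member (∈-lookup i))) (≢w (member (∈-lookup j))) adj
        (trans (sym (toℕ-fromℕ< _)) (trans (cong toℕ eq) (toℕ-fromℕ< _))))

  -- The closed neighborhood of x is a clique with more than k vertices,
  -- so by criticality no vertex lies outside it.
  clique⇒complete : ∀ x → (∀ {a b} → x ~ a → x ~ b → a ≢ b → ¬ ¬ a ~ b) →
    ∀ {p q} → p ≢ q → ¬ ¬ p ~ q
  clique⇒complete x clique {p} {q} p≢q p≁q with p ≟ x | q ≟ x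
  ... | yes refl | yes refl = p≢q refl
  ... | yes refl | no q≢x   = clique-dominates x clique q≢x p≁q
  ... | no p≢x   | yes refl = clique-dominates x clique p≢x (p≁q ∘ ~-sym)
  ... | no p≢x   | no q≢x   = clique-dominates x clique p≢x λ x~p →
    clique-dominates x clique q≢x λ x~q → clique x~p x~q p≢q p≁q

  -- Recoloring the neighbors of a twin

  module _ {x y v} (low-x : Low x) (low-y : Low y) (low-v : Low v)
    (x~y : x ~ y) (x~v : x ~ v) (y~v : y ~ v)
    (dominates-y : ∀ {z} → x ~ z → z ≢ y → y ~ z)
    (dominates-v : ∀ {z} → x ~ z → z ≢ v → v ~ z)
    where

    private
      c : V → ℕ
      c = proj₁ (colorable-off x)

      c-off : ColoringOff (_≡ x) c
      c-off = proj₁ (proj₂ (colorable-off x)) , λ a≢x b≢x → proj₂ (proj₂ (colorable-off x)) a≢x b≢x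

      -- Contains `x` itself. These vertices give up their colors: they are low and adjacent to
      -- every `Outer` vertex, so they can be colored greedily once two outer vertices have the same
      -- color.
      W : Pred V 0ℓ
      W z = Low z × (∀ t → x ~ t → t ≢ z → z ~ t)

      W? : Decidable W
      W? z = low? z ×-dec all? λ t → (x ~? t) →-dec (¬? (t ≟ z) →-dec (z ~? t))

      W-x : W x
      W-x = low-x , λ t x~t _ → x~t

      c-off-W : ColoringOff W c
      c-off-W = proj₁ c-off , λ ¬Wa ¬Wb → proj₂ c-off (λ { refl → ¬Wa W-x }) (λ { refl → ¬Wb W-x })

      rainbow : x ~ a → x ~ b → c a ≡ c b → a ≡ b
      rainbow {a} {b} x~a x~b ca≡cb = decidable-stable (a ≟ b) λ a≢b →
        greedy′ (_≟ x) a≢b (λ { refl → ~-irrefl x~a }) (λ { refl → ~-irrefl x~b })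
          (λ { refl → low-x , x~a , x~b }) c-off ca≡cb

      Outer : Pred V 0ℓ
      Outer a = x ~ a × ¬ W a

      W-adjacent : Outer a → W z → z ~ a
      W-adjacent (x~a , ¬Wa) Wz = proj₂ Wz _ x~a λ { refl → ¬Wa Wz }

      outer-rainbow : ∀ {c} → ColoringOff W c → Outer a → Outer b → a ≢ b → c a ≢ c b
      outer-rainbow C oa ob a≢b = greedy′ W? a≢b (proj₂ oa) (proj₂ ob)
        (λ Ww → proj₁ Ww , W-adjacent oa Ww , W-adjacent ob Ww) C

      Sees : V → V → Set
      Sees a q = ∃ λ z → a ~ z × ¬ W z × c z ≡ c q

      sees? : ∀ a q → Dec (Sees a q)
      sees? a q = any? λ z → (a ~? z) ×-dec (¬? (W? z) ×-dec (c z ℕ.≟ c q))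

      -- Otherwise `a` could take the color of `q`, against `outer-rainbow`.
      sees-outer : Outer a → Outer q → q ≢ a → Sees a q
      sees-outer {a} {q} oa oq q≢a = decidable-stable (sees? a q) λ unseen →
        outer-rainbow (recolor c-off-W (λ ¬Wz _ → ¬Wz) (proj₁ c-off q) λ a~z ¬Wz eq → unseen (_ , a~z , ¬Wz , eq))
          oa oq (q≢a ∘ sym) (trans (≔-same c a) (sym (≔-other c q≢a)))

      -- The neighborhood of a contains W, one vertex for each color of another outer vertex,
      -- and one more vertex for each seen color of W.
      module _ {a} (oa : Outer a) where

        -- For neighbors `z` of `x`, an injection into the neighborhood of `a`. Not being its own
        -- neighbor, `a` is sent to `x`, which is not taken otherwise.
        Image : V → V → Set
        Image z w = z ≡ a × w ≡ x ⊎ W z × w ≡ z ⊎ (¬ W z × ¬ W w × c w ≡ c z)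

        image : ∀ z → x ~ z → ∃ λ w → a ~ w × Image z w
        image z x~z with z ≟ a | W? z
        ... | yes refl | _     = x , ~-sym x~z , inj₁ (refl , refl)
        ... | no _     | yes Wz = z , ~-sym (W-adjacent oa Wz) , inj₂ (inj₁ (Wz , refl))
        ... | no z≢a   | no ¬Wz with sees-outer oa (x~z , ¬Wz) z≢a
        ... | w , a~w , ¬Ww , eq = w , a~w , inj₂ (inj₂ (¬Wz , ¬Ww , eq))

        image-injective : ∀ {z z′ w} → x ~ z → x ~ z′ → Image z w → Image z′ w → z ≡ z′
        image-injective _ _ (inj₁ (z≡a , _)) (inj₁ (z′≡a , _)) = trans z≡a (sym z′≡a)
        image-injective _ x~z′ (inj₁ (_ , refl)) (inj₂ (inj₁ (_ , refl))) = contradiction x~z′ ~-irrefl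
        image-injective x~z _ (inj₂ (inj₁ (_ , refl))) (inj₁ (_ , refl)) = contradiction x~z ~-irrefl
        image-injective _ _ (inj₁ (_ , refl)) (inj₂ (inj₂ (_ , ¬Wx , _))) = contradiction W-x ¬Wx
        image-injective _ _ (inj₂ (inj₂ (_ , ¬Wx , _))) (inj₁ (_ , refl)) = contradiction W-x ¬Wx
        image-injective _ _ (inj₂ (inj₁ (_ , refl))) (inj₂ (inj₁ (_ , refl))) = refl
        image-injective _ _ (inj₂ (inj₁ (Wz , refl))) (inj₂ (inj₂ (_ , ¬Wz , _))) = contradiction Wz ¬Wz
        image-injective _ _ (inj₂ (inj₂ (_ , ¬Wz , _))) (inj₂ (inj₁ (Wz , refl))) = contradiction Wz ¬Wz
        image-injective x~z x~z′ (inj₂ (inj₂ (_ , _ , eq))) (inj₂ (inj₂ (_ , _ , eq′))) =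
          rainbow x~z x~z′ (trans (sym eq) eq′)

        image-fresh : ∀ {z w q} → x ~ z → Image z w → W q → x ~ q → ¬ W w → c w ≢ c q
        image-fresh _ (inj₁ (_ , refl)) _ _ ¬Wx _ = ¬Wx W-x
        image-fresh _ (inj₂ (inj₁ (Wz , refl))) _ _ ¬Wz _ = ¬Wz Wz
        image-fresh x~z (inj₂ (inj₂ (¬Wz , _ , eq))) Wq x~q _ eq′ =
          ¬Wz (subst W (sym (rainbow x~z x~q (trans (sym eq) eq′))) Wq)

        neighbor : Fin (# (x ~?_)) → V
        neighbor = lookup (elements (x ~?_))

        x~neighbor : ∀ i → x ~ neighbor i
        x~neighbor i = ∈-elements⁻ (x ~?_) (∈-lookup i)

        images : List V
        images = tabulate λ i → proj₁ (image (neighbor i) (x~neighbor i))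

        images! : Unique images
        images! = Unique.tabulate⁺ λ {i} {j} eq → Unique-lookup-injective (elements! (x ~?_))
          (image-injective (x~neighbor i) (x~neighbor j)
            (proj₂ (proj₂ (image (neighbor i) (x~neighbor i))))
            (subst (Image _) (sym eq) (proj₂ (proj₂ (image (neighbor j) (x~neighbor j))))))

        a~images : All (a ~_) images
        a~images = All.tabulate⁺ λ i → proj₁ (proj₂ (image (neighbor i) (x~neighbor i)))

        k≤images : k ≤ length images
        k≤images = subst (k ≤_) (sym (length-tabulate _)) (degree-≥ x)

        fresh-images : W q → x ~ q → ¬ W w → c w ≡ c q → All (w ≢_) images
        fresh-images Wq x~q ¬Ww eq = All.tabulate⁺ λ i → λ { refl →
          image-fresh (x~neighbor i) (proj₂ (proj₂ (image (neighbor i) (x~neighbor i)))) Wq x~q ¬Ww eq }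

        low-free : Low a → W q → x ~ q → ¬ Sees a q
        low-free low-a Wq x~q (w , a~w , ¬Ww , eq) = ℕ.<⇒≱ (s≤s k≤images) (ℕ.≤-trans
          (≤# (a ~?_) (fresh-images Wq x~q ¬Ww eq ∷ images!) (a~w ∷ a~images)) low-a)

        -- The images leave room for only one more neighbor of `a`, and witnesses for two colors
        -- would be distinct by `rainbow`.
        one-seen : W q → x ~ q → W u → x ~ u → q ≢ u → Sees a q → ¬ Sees a u
        one-seen Wq x~q Wu x~u q≢u (w , a~w , ¬Ww , eq) (w′ , a~w′ , ¬Ww′ , eq′) =
          ℕ.<⇒≱ (s≤s (s≤s k≤images)) (ℕ.≤-trans
            (≤# (a ~?_)
              (((λ { refl → q≢u (rainbow x~q x~u (trans (sym eq) eq′)) }) ∷ fresh-images Wq x~q ¬Ww eq) ∷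
               fresh-images Wu x~u ¬Ww′ eq′ ∷ images!)
              (a~w ∷ a~w′ ∷ a~images))
            (degree-≤ a))

      module _ {a b} (oa : Outer a) (ob : Outer b) (a≢b : a ≢ b) (a≁b : ¬ a ~ b) where

        -- Otherwise the nonadjacent `a` and `b` could both be given the color of `q`, against
        -- `outer-rainbow`.
        blocked : W q → x ~ q → Sees a q ⊎ Sees b q
        blocked {q} Wq x~q with sees? a q | sees? b q
        ... | yes seen | _        = inj₁ seen
        ... | no _     | yes seen = inj₂ seen
        ... | no a-free | no b-free = ⊥-elim (outer-rainbow C₂ oa ob a≢b
          (trans (≔-other c₁ a≢b) (trans (≔-same c a) (sym (≔-same c₁ b)))))
          where
          c₁ = c [ a ≔ c q ]
          C₁ : ColoringOff W c₁
          C₁ = recolor c-off-W (λ ¬Wz _ → ¬Wz) (proj₁ c-off q) λ a~z ¬Wz eq → a-free (_ , a~z , ¬Wz , eq)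
          C₂ : ColoringOff W (c₁ [ b ≔ c q ])
          C₂ = recolor C₁ (λ ¬Wz _ → ¬Wz) (proj₁ c-off q) λ {z} b~z ¬Wz eq →
            b-free (z , b~z , ¬Wz , trans (sym (≔-other c λ { refl → a≁b (~-sym b~z) })) eq)

      W-y : W y
      W-y = low-y , λ t x~t t≢y → dominates-y x~t t≢y

      W-v : W v
      W-v = low-v , λ t x~t t≢v → dominates-v x~t t≢v

      y≢v : y ≢ v
      y≢v refl = ~-irrefl y~v

      both-blocked : Outer b → Sees b y → ¬ Sees b v
      both-blocked ob = one-seen ob W-y x~y W-v x~v y≢v

      -- A low `a` sees the color of neither `y` nor `v`, so `b` would have to see both.
      low-adjacent : Outer a → Low a → Outer b → a ≢ b → ¬ ¬ a ~ b
      low-adjacent oa low-a ob a≢b a≁b with blocked oa ob a≢b a≁b W-y x~y | blocked oa ob a≢b a≁b W-v x~v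
      ... | inj₁ seen | _          = low-free oa low-a W-y x~y seen
      ... | _         | inj₁ seen  = low-free oa low-a W-v x~v seen
      ... | inj₂ seen | inj₂ seen′ = both-blocked ob seen seen′

      high-adjacent : Outer a → ¬ Low a → Outer b → ¬ Low b → a ≢ b → ¬ ¬ a ~ b
      high-adjacent {a} {b} oa high-a ob high-b a≢b a≁b
        -- Here `5 ≤ k` is used: `x` has a fifth neighbor `e`.
        with fresh (x ~?_) (a ∷ b ∷ y ∷ v ∷ []) (ℕ.≤-trans 5≤k (degree-≥ x))
      ... | e , x~e , e∉ = by-cases (W? e) (low? e)
        where
        e≢a : e ≢ a
        e≢a eq = e∉ (here eq)
        e≢b : e ≢ b
        e≢b eq = e∉ (there (here eq))
        e≢y : e ≢ y
        e≢y eq = e∉ (there (there (here eq)))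
        e≢v : e ≢ v
        e≢v eq = e∉ (there (there (there (here eq))))
        high-apart : ∀ {p q} → ¬ Low p → ¬ Low q → ¬ p ~ q
        high-apart high-p high-q p~q = high-q (high-independent p~q high-p)
        ab : ∀ {t} → W t → x ~ t → Sees a t ⊎ Sees b t
        ab = blocked oa ob a≢b a≁b
        by-cases : Dec (W e) → Dec (Low e) → ⊥
        -- The colors of `y`, `v` and `e` must each be seen by `a` or `b`, but each of these two
        -- sees at most one.
        by-cases (yes We) _ with ab W-y x~y | ab W-v x~v | ab We x~e
        ... | inj₁ s | inj₁ s′ | _       = both-blocked oa s s′
        ... | inj₂ s | inj₂ s′ | _       = both-blocked ob s s′
        ... | inj₁ s | inj₂ _  | inj₁ s″ = one-seen oa W-y x~y We x~e (e≢y ∘ sym) s s″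
        ... | inj₁ _ | inj₂ s′ | inj₂ s″ = one-seen ob W-v x~v We x~e (e≢v ∘ sym) s′ s″
        ... | inj₂ _ | inj₁ s′ | inj₁ s″ = one-seen oa W-v x~v We x~e (e≢v ∘ sym) s′ s″
        ... | inj₂ s | inj₁ _  | inj₂ s″ = one-seen ob W-y x~y We x~e (e≢y ∘ sym) s s″
        -- A low outer vertex is adjacent to all other neighbors of `x`, which puts it in `W`.
        by-cases (no ¬We) (yes low-e) = ¬We (low-e , λ t x~t t≢e → decidable-stable (e ~? t) λ e≁t →
          low-adjacent (x~e , ¬We) low-e (x~t , λ Wt → e≁t (~-sym (W-adjacent (x~e , ¬We) Wt))) (t≢e ∘ sym) e≁t)
        -- Of the pairwise nonadjacent `a`, `b`, `e`, at least two must see the color of `y` and two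
        -- that of `v`, but each sees at most one of them.
        by-cases (no ¬We) (no high-e) = pigeonhole
          where
          oe : Outer e
          oe = x~e , ¬We
          ae : ∀ {t} → W t → x ~ t → Sees a t ⊎ Sees e t
          ae = blocked oa oe (e≢a ∘ sym) (high-apart high-a high-e)
          be : ∀ {t} → W t → x ~ t → Sees b t ⊎ Sees e t
          be = blocked ob oe (e≢b ∘ sym) (high-apart high-b high-e)
          pigeonhole : ⊥
          pigeonhole with ab W-y x~y | ab W-v x~v | ae W-y x~y | ae W-v x~v | be W-y x~y | be W-v x~v
          ... | inj₁ s | inj₁ s′ | _ | _ | _ | _ = both-blocked oa s s′
          ... | inj₂ s | inj₂ s′ | _ | _ | _ | _ = both-blocked ob s s′
          ... | inj₁ s | inj₂ _  | _ | inj₁ s′ | _ | _ = both-blocked oa s s′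
          ... | inj₁ _ | inj₂ _  | _ | inj₂ s′ | inj₂ s | _ = both-blocked oe s s′
          ... | inj₁ _ | inj₂ s′ | _ | inj₂ _  | inj₁ s | _ = both-blocked ob s s′
          ... | inj₂ _ | inj₁ s′ | inj₁ s | _ | _ | _ = both-blocked oa s s′
          ... | inj₂ s | inj₁ _  | inj₂ _ | _ | _ | inj₁ s′ = both-blocked ob s s′
          ... | inj₂ _ | inj₁ _  | inj₂ s | _ | _ | inj₂ s′ = both-blocked oe s s′

    twins⇒complete : ∀ {p q} → p ≢ q → ¬ ¬ p ~ q
    twins⇒complete = clique⇒complete x λ {a} {b} x~a x~b a≢b a≁b →
      -- A member of `W` would be adjacent to the other vertex, so both are outer.
      let oa = x~a , λ Wa → a≁b (proj₂ Wa b x~b (a≢b ∘ sym))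
          ob = x~b , λ Wb → a≁b (~-sym (proj₂ Wb a x~a a≢b))
      in case-low oa ob a≢b a≁b (low? a) (low? b)
      where
      case-low : Outer a → Outer b → a ≢ b → ¬ a ~ b → Dec (Low a) → Dec (Low b) → ⊥
      case-low oa ob a≢b a≁b (yes low-a) _ = low-adjacent oa low-a ob a≢b a≁b
      case-low oa ob a≢b a≁b _ (yes low-b) = low-adjacent ob low-b oa (a≢b ∘ sym) (a≁b ∘ ~-sym)
      case-low oa ob a≢b a≁b (no high-a) (no high-b) = high-adjacent oa high-a ob high-b a≢b a≁b

-- From graphs to adjacency relations

module _ (G : Graph) where

  private
    _~_ = Adj G
    _~?_ = adj? G

  chromatic-minimal : ∀ {k} → k < χ G → ¬ Colorable G k
  chromatic-minimal k<χ colorable = ℕ.<⇒≱ k<χ (proj₂ (proj₂ (chromatic G)) colorable)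

  uncolorable : ∀ {k} → k < χ G → (c : Vertex G → ℕ) → (∀ v → c v < k) → ¬ (∀ {a b} → a ~ b → c a ≢ c b)
  uncolorable k<χ c c<k proper = chromatic-minimal k<χ
    ((λ v → fromℕ< (c<k v)) , λ a b a~b eq →
      proper a~b (trans (sym (toℕ-fromℕ< (c<k a))) (trans (cong toℕ eq) (toℕ-fromℕ< (c<k b)))))

  colorable-without : ∀ {k} → 0 < k → ∀ x → χ (G - x) ≤ k → ∃ λ (c : Vertex G → ℕ) →
    (∀ v → c v < k) × (∀ {a b} → a ≢ x → b ≢ x → a ~ b → c a ≢ c b)
  colorable-without {k} 0<k x χ≤k = c , c<k , λ {a} {b} → c-proper a b
    where
    kept : List (Vertex G)
    kept = filter (λ u → ¬? (u ≟ x)) (vertices G)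
    coloring : Vertex (G - x) → Fin (χ (G - x))
    coloring = proj₁ (proj₁ (proj₂ (chromatic (G - x))))
    kept∈ : ∀ {v} → v ≢ x → v ∈ kept
    kept∈ = ∈-filter⁺ (λ u → ¬? (u ≟ x)) (∈-allFin _)
    c : Vertex G → ℕ
    c v with v ≟ x
    ... | yes _  = 0
    ... | no v≢x = toℕ (coloring (Any.index (kept∈ v≢x)))
    c<k : ∀ v → c v < k
    c<k v with v ≟ x
    ... | yes _ = 0<k
    ... | no _  = ℕ.<-≤-trans (toℕ<n _) χ≤k
    c-proper : ∀ a b → a ≢ x → b ≢ x → a ~ b → c a ≢ c b
    c-proper a b a≢x b≢x a~b with a ≟ x | b ≟ x
    ... | yes a≡x | _       = contradiction a≡x a≢x
    ... | no _    | yes b≡x = contradiction b≡x b≢x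
    ... | no a≢x  | no b≢x  = λ eq → proj₂ (proj₁ (proj₂ (chromatic (G - x)))) _ _
      (subst₂ _~_ (lookup-index (kept∈ a≢x)) (lookup-index (kept∈ b≢x)) a~b) (toℕ-injective eq)

  degree-≤-Δ : ∀ v → degree G v ≤ Δ G
  degree-≤-Δ v = All.lookup (xs≤max 0 (map (degree G) (vertices G))) (∈-map⁺ (degree G) (∈-allFin v))

  ℋ-edgeless⇒ : Edgeless (ℋ G) → ∀ {a b} → χ G ≤ degree G a → χ G ≤ degree G b → ¬ a ~ b
  ℋ-edgeless⇒ edgeless {a} {b} high-a high-b a~b = edgeless (Any.index a∈) (Any.index b∈)
    (subst₂ _~_ (lookup-index a∈) (lookup-index b∈) a~b)
    where
    highs : List (Vertex G)
    highs = filter (λ v → χ G ℕ.≤? degree G v) (vertices G)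
    a∈ : a ∈ highs
    a∈ = ∈-filter⁺ _ (∈-allFin a) high-a
    b∈ : b ∈ highs
    b∈ = ∈-filter⁺ _ (∈-allFin b) high-b

  complete⇒≅K : (∀ u v → u ≢ v → u ~ v) → G ≅ K (χ G)
  complete⇒≅K complete = subst (λ k → G ≅ K k) order≡χ record
    { bijection = ↔-id _
    ; adjacency = λ u v → mk⇔ (λ u~v u≡v → irrefl G u≡v u~v) (complete u v)
    }
    where
    order≡χ : order G ≡ χ G
    order≡χ with proj₁ (proj₂ (chromatic G))
    ... | c , proper = ℕ.≤-antisym
      (injective⇒≤ {f = c} λ {u} {v} cu≡cv →
        decidable-stable (u ≟ v) λ u≢v → proper u v (complete u v u≢v) cu≡cv)
      (proj₂ (proj₂ (chromatic G)) (order-colorable G))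

  critical-complete : ∀ {m} → 3 ≤ m → χ G ≡ 3 + m → Critical G → Δ G ≤ χ G → Edgeless (ℋ G) →
    ∀ u v → u ≢ v → u ~ v
  critical-complete {m} 3≤m χ≡ critical Δ≤χ edgeless u v u≢v =
    decidable-stable (u ~? v) λ u≁v → exists-triple start λ τ →
      let open Triple τ in
      twins⇒complete low₁ low₂ low₃ x₁~x₂ x₁~x₃ x₂~x₃ dominates₂ dominates₃ u≢v u≁v
    where
    k : ℕ
    k = 2 + m
    k<χ : k < χ G
    k<χ = ℕ.≤-reflexive (sym χ≡)
    -- The palettes have sizes 2 and `m`, together `k`; `offset` puts them side by side below `k`.
    r : Bool → ℕ
    r i = if i then 2 else m
    2≤r : ∀ i → 2 ≤ r i
    2≤r true  = ℕ.≤-refl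
    2≤r false = ℕ.≤-trans (ℕ.n≤1+n 2) 3≤m
    offset : Bool → ℕ → ℕ
    offset i γ = if i then γ else 2 + γ
    offset-< : ∀ i {γ} → γ < r i → offset i γ < k
    offset-< true  γ<2 = ℕ.≤-trans γ<2 (ℕ.m≤m+n 2 m)
    offset-< false γ<m = s≤s (s≤s γ<m)
    offset-injective : ∀ i j {γ δ} → γ < r i → δ < r j → offset i γ ≡ offset j δ → i ≡ j × γ ≡ δ
    offset-injective true  true  _ _ eq   = refl , eq
    offset-injective false false _ _ refl = refl , refl
    offset-injective true  false γ<2 _ refl = contradiction γ<2 (ℕ.≤⇒≯ (ℕ.m≤m+n 2 _))
    offset-injective false true  _ δ<2 refl = contradiction δ<2 (ℕ.≤⇒≯ (ℕ.m≤m+n 2 _))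
    uncolorable-sides : ∀ (s : Vertex G → Bool) c → (∀ v → c v < r (s v)) →
      ¬ (∀ {a b} → a ~ b → s a ≡ s b → c a ≢ c b)
    uncolorable-sides s c c<r proper = uncolorable k<χ (λ v → offset (s v) (c v)) (λ v → offset-< (s v) (c<r v))
      λ {a} {b} a~b eq → let (sa≡sb , ca≡cb) = offset-injective (s a) (s b) (c<r a) (c<r b) eq in
        proper a~b sa≡sb ca≡cb
    colorable-off : ∀ x → ∃ λ (c : Vertex G → ℕ) →
      (∀ v → c v < k) × (∀ {a b} → a ≢ x → b ≢ x → a ~ b → c a ≢ c b)
    colorable-off x = colorable-without (s≤s z≤n) x (s≤s⁻¹ (subst (χ (G - x) <_) χ≡ (critical x)))
    degree-≤ : ∀ v → # (v ~?_) ≤ suc k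
    degree-≤ v = ℕ.≤-trans (degree-≤-Δ v) (subst (Δ G ≤_) χ≡ Δ≤χ)
    high : ∀ {a} → ¬ # (a ~?_) ≤ k → χ G ≤ degree G a
    high {a} ≰k = subst (_≤ degree G a) (sym χ≡) (ℕ.≰⇒> ≰k)
    high-independent : ∀ {a b} → a ~ b → ¬ # (a ~?_) ≤ k → # (b ~?_) ≤ k
    high-independent {a} {b} a~b a≰k = decidable-stable (_ ℕ.≤? k) λ b≰k →
      ℋ-edgeless⇒ edgeless (high a≰k) (high b≰k) a~b
    open Recoloring (order G) _~_ _~?_ (symm G) (irrefl G refl) k (s≤s (s≤s 3≤m)) (uncolorable k<χ) colorable-off
      degree-≤ high-independent
    open Walks (order G) _~_ _~?_ (symm G) (irrefl G refl) r 2≤r uncolorable-sides Low low? id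
      degree-≤ high-independent
    split : ∀ γ → γ < k → ∃₂ λ i δ → δ < r i × offset i δ ≡ γ
    split 0 _ = true , 0 , s≤s z≤n , refl
    split 1 _ = true , 1 , s≤s (s≤s z≤n) , refl
    split (suc (suc γ)) (s≤s (s≤s γ<m)) = false , γ , γ<m , refl
    side-color : ∀ x v → ∃₂ λ i δ → δ < r i × offset i δ ≡ proj₁ (colorable-off x) v
    side-color x v = split _ (proj₁ (proj₂ (colorable-off x)) v)
    -- Criticality gives a coloring with `u` as the hole; the side of each vertex is read off from
    -- its color.
    start : Coloring (λ v → proj₁ (side-color u v)) u
    start = record
      { color  = λ v → proj₁ (proj₂ (side-color u v))
      ; bound  = λ v → proj₁ (proj₂ (proj₂ (side-color u v)))
      ; proper = λ {a} {b} a≢u b≢u (a~b , sides) colors → proj₂ (proj₂ (colorable-off u)) a≢u b≢u a~b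
          (trans (sym (proj₂ (proj₂ (proj₂ (side-color u a)))))
            (trans (cong₂ offset sides colors) (proj₂ (proj₂ (proj₂ (side-color u b))))))
      }

corollaryN : (G : Graph) → Critical G → χ G ≥ Δ G → Δ G ≥ 6 →
    Edgeless (ℋ G) → G ≅ K (χ G)
corollaryN G critical χ≥Δ Δ≥6 edgeless = complete⇒≅K G
  -- From `6 ≤ χ G` follows `3 ≤ m`, so that `k = 2 + m` is at least 5.
  (critical-complete G {m = χ G ∸ 3} (ℕ.∸-monoˡ-≤ 3 6≤χ) (sym (ℕ.m+[n∸m]≡n (ℕ.≤-trans (ℕ.m≤m+n 3 3) 6≤χ)))
    critical χ≥Δ edgeless)
  where
  6≤χ : 6 ≤ χ G
  6≤χ = ℕ.≤-trans Δ≥6 χ≥Δ
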